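{- Let $k$ be a positive integer with $k\equiv\pm3\pmod 9$, let $\epsilon\in\{\pm1\}$ be such that $k\equiv 3\epsilon\pmod 9$, let $\alpha=\sqrt[3]{2}-1$, and let $B>0$ be a real number. For integers $d>0$ with $\gcd(d,3)=1$ and $z\in\mathbb{Z}$, let $S(d,z)$ denote the conjunction of the following four conditions: $$\frac{d}{\sqrt[3]{2}-1}<|z|\le B,\qquad \operatorname{sgn}(z)=\epsilon\left(\frac{d}{3}\right),\qquad z^3\equiv k\pmod d,$$ $$3d\left(4\epsilon\left(\frac{d}{3}\right)(z^3-k)-d^3\right)\ \text{is the square of an integer}.$$ (a) Suppose $(x,y,z)\in\mathbb{Z}^3$ satisfies $x^3+y^3+z^3=k$, $|x|\ge|y|\ge|z|>\sqrt{k}$, $y\ne z$ and $|z|\le B$. Set $d=|x+y|$. Then $0<d<\alpha B$, $\gcd(d,3)=1$, the condition $S(d,z)$ holds, and $$\{x,y\}=\left\{\frac12\operatorname{sgn}(k-z^3)\left(d\pm\sqrt{\frac{4|k-z^3|-d^3}{3d}}\right)\right\}.$$ (b) Conversely, if $d\in\mathbb{Z}\cap(0,\alpha B)$ is coprime to $3$ and $z\in\mathbb{Z}$ is such that $S(d,z)$ holds, then the two numbers $$\frac12\operatorname{sgn}(k-z^3)\left(d\pm\sqrt{\frac{4|k-z^3|-d^3}{3d}}\right)$$ are integers, and calling them $x$ and $y$ one has $x^3+y^3+z^3=k$.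
   Context: Here $\left(\frac{d}{3}\right)$ is the Legendre symbol modulo $3$ (equal to $1$ if $d\equiv1\pmod3$ and $-1$ if $d\equiv2\pmod 3$), and $\operatorname{sgn}$ denotes the sign of a real number. -}

module Defs where

open import Level using (_⊔_) renaming (suc to lsuc)
open import Data.Nat.Base as ℕ using (ℕ; zero; suc)
open import Data.Integer.Base as ℤ using (ℤ; +_; -[1+_]; +[1+_]; ∣_∣; 0ℤ; 1ℤ; -1ℤ; _%ℕ_)
import Data.Integer.Properties as ℤ
open import Data.Integer.Divisibility using (_∣_)
open import Data.Product.Base using (∃-syntax; _×_; _,_; proj₁)
open import Data.Sum.Base using (_⊎_)
open import Relation.Nullary.Negation using (¬_)
open import Relation.Unary using (Pred)
open import Relation.Binary.Core using (Rel)
open import Relation.Binary.Structures using (IsStrictPartialOrder)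
open import Relation.Binary.PropositionalEquality using (_≡_)
open import Algebra.Bundles using (CommutativeRing; Semiring)
open import Algebra.Apartness.Bundles using (HeytingField)
import Algebra.Definitions.RawSemiring as RawSemiringDefs
import Algebra.Apartness.Properties.HeytingCommutativeRing as HCRProperties
import Relation.Binary.Reasoning.Setoid as ≈-Reasoning
import Algebra.Properties.Ring as RingProperties
import Algebra.Solver.Ring.NaturalCoefficients.Default as NatSolver

infix 4 _≋_[mod_]

_≋_[mod_] : ℤ → ℤ → ℤ → Set
a ≋ b [mod m ] = m ∣ (a ℤ.- b)

IsSquare : ℤ → Set
IsSquare a = ∃[ n ] a ≡ n ℤ.* n

-- Data.Integer.Base.sign is two-valued, with sign 0 positive;
-- this is the usual real sign function, with value 0 at 0.
sgn : ℤ → ℤ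
sgn (+ 0)    = 0ℤ
sgn +[1+ _ ] = 1ℤ
sgn -[1+ _ ] = -1ℤ

legendre₃ : ℤ → ℤ
legendre₃ d with d %ℕ 3
... | 0 = 0ℤ
... | 1 = 1ℤ
... | _ = -1ℤ

-- The real numbers, given axiomatically as an Archimedean, Cauchy complete
-- ordered field.  The axioms are the constructive ones: no decidability of the
-- order is asked for, so that Bishop's and Dedekind's reals, as well as the
-- classical reals, are covered.
record Reals c ℓ₁ ℓ₂ : Set (lsuc (c ⊔ ℓ₁ ⊔ ℓ₂)) where
  infix 4 _<_ _≤_
  field
    heytingField : HeytingField c ℓ₁ ℓ₂
  open HeytingField heytingField public
    using (Carrier; _≈_; _#_; _+_; _*_; -_; 0#; 1#; heytingCommutativeRing; _-_;
           #⇒invertible; invertible⇒#; #-irrefl; #-sym; #-cotrans; tight)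

  commutativeRing : CommutativeRing c ℓ₁
  commutativeRing = record { isCommutativeRing = HeytingField.isCommutativeRing heytingField }

  open RawSemiringDefs (Semiring.rawSemiring (CommutativeRing.semiring commutativeRing)) public
    using (_^_) renaming (_×_ to _·_)

  field
    _<_                  : Rel Carrier ℓ₂
    isStrictPartialOrder : IsStrictPartialOrder _≈_ _<_
    #⇒<⊎>                : ∀ {x y} → x # y → x < y ⊎ y < x
    <⇒#                  : ∀ {x y} → x < y → x # y
    +-monoˡ-<            : ∀ {x y} z → x < y → x + z < y + z
    *-pos                : ∀ {x y} → 0# < x → 0# < y → 0# < x * y
    0<1                  : 0# < 1#

  _≤_ : Rel Carrier ℓ₂
  x ≤ y = ¬ (y < x)

  IsCauchy : Pred (ℕ → Carrier) (c ⊔ ℓ₂)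
  IsCauchy u = ∀ ε → 0# < ε →
    ∃[ N ] ∀ m n → N ℕ.≤ m → N ℕ.≤ n → u m < u n + ε

  _ConvergesTo_ : (ℕ → Carrier) → Carrier → Set (c ⊔ ℓ₂)
  u ConvergesTo l = ∀ ε → 0# < ε →
    ∃[ N ] ∀ n → N ℕ.≤ n → u n < l + ε × l < u n + ε

  field
    archimedean : ∀ x → ∃[ n ] x < n · 1#
    complete    : ∀ u → IsCauchy u → ∃[ l ] u ConvergesTo l

  -- The existence of roots follows from completeness; it is part of the
  -- structure only in order to give them a name.
  field
    root         : ∀ n .{{_ : ℕ.NonZero n}} x → 0# ≤ x → Carrier
    root-nonNeg  : ∀ n .{{_ : ℕ.NonZero n}} x (x≥0 : 0# ≤ x) → 0# ≤ root n x x≥0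
    root-^       : ∀ n .{{_ : ℕ.NonZero n}} x (x≥0 : 0# ≤ x) → root n x x≥0 ^ n ≈ x

module RealNotions {c ℓ₁ ℓ₂} (R : Reals c ℓ₁ ℓ₂) where

  open Reals R public
    using (_≈_; _#_; 0#; 1#)
    renaming (Carrier to ℝ; _+_ to _+ᴿ_; _-_ to _-ᴿ_; _*_ to _*ᴿ_; -_ to -ᴿ_;
              _<_ to _<ᴿ_; _≤_ to _≤ᴿ_)
  open Reals R
    using (commutativeRing; heytingCommutativeRing; _·_; #⇒invertible; <⇒#; #-sym;
           isStrictPartialOrder; +-monoˡ-<; 0<1; root; root-^)
  private
    module CR = CommutativeRing commutativeRing
    module < = IsStrictPartialOrder isStrictPartialOrder

  infixl 7 _/_[_]
  infix  4 _≥ᴿ0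

  _≥ᴿ0 : ℝ → Set ℓ₂
  x ≥ᴿ0 = 0# ≤ᴿ x

  ι : ℤ → ℝ
  ι (+ n)    = n · 1#
  ι -[1+ n ] = -ᴿ (suc n · 1#)

  -- #⇒invertible y#0 is an inverse of y - 0#.
  _/_[_] : ∀ (x y : ℝ) → y # 0# → ℝ
  x / y [ y#0 ] = x *ᴿ proj₁ (#⇒invertible y#0)

  √ : ∀ x → x ≥ᴿ0 → ℝ
  √ = root 2

  ∛ : ∀ x → x ≥ᴿ0 → ℝ
  ∛ = root 3

  ι-pos : ∀ {i} → 0ℤ ℤ.< i → 0# <ᴿ ι i
  ι-pos {+[1+ n ]} _         = lemma n
    where
    step : ∀ {x} → 0# <ᴿ x → 0# <ᴿ 1# +ᴿ x
    step {x} 0<x = <.trans 0<x (<.<-respˡ-≈ (CR.+-identityˡ x) (+-monoˡ-< x 0<1))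

    lemma : ∀ n → 0# <ᴿ suc n · 1#
    lemma zero    = <.<-respʳ-≈ (CR.sym (CR.+-identityʳ 1#)) 0<1
    lemma (suc n) = step (lemma n)
  ι-pos {+ 0}      (ℤ.+<+ ())

  ι-nonNeg : ∀ {i} → 0ℤ ℤ.< i → ι i ≥ᴿ0
  ι-nonNeg i>0 i<0 = <.irrefl CR.refl (<.trans (ι-pos i>0) i<0)

  ι-#0 : ∀ {i} → 0ℤ ℤ.< i → ι i # 0#
  ι-#0 i>0 = #-sym (<⇒# (ι-pos i>0))

  2>0 : 0ℤ ℤ.< + 2
  2>0 = ℤ.+<+ (ℕ.s≤s ℕ.z≤n)

  α : ℝ
  α = ∛ (ι (+ 2)) (ι-nonNeg 2>0) -ᴿ ι 1ℤ

  α#0 : α # 0#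
  α#0 = HCRProperties.invertibleˡ⇒# heytingCommutativeRing (a * a + 3· a + 3· 1# , +-cancelʳ 1# _ _ eq)
    where
    open CommutativeRing commutativeRing hiding (refl; sym; _≈_; 0#; 1#)
    open RingProperties ring using (+-cancelʳ; -0#≈0#)
    open NatSolver commutativeSemiring
    open ≈-Reasoning setoid

    3·_ : ℝ → ℝ
    3· x = x + x + x

    c₀ a : ℝ
    c₀ = ∛ (ι (+ 2)) (ι-nonNeg 2>0)
    a  = α - 0#

    a+1≈c₀ : a + 1# ≈ c₀
    a+1≈c₀ = begin
      (c₀ - (1# + 0#)) - 0# + 1#  ≈⟨ +-congʳ (+-cong (+-congˡ (-‿cong (+-identityʳ 1#))) -0#≈0#) ⟩
      (c₀ - 1#) + 0# + 1#         ≈⟨ +-congʳ (+-identityʳ _) ⟩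
      (c₀ - 1#) + 1#              ≈⟨ +-assoc c₀ (- 1#) 1# ⟩
      c₀ + (- 1# + 1#)            ≈⟨ +-congˡ (-‿inverseˡ 1#) ⟩
      c₀ + 0#                     ≈⟨ +-identityʳ c₀ ⟩
      c₀                          ∎

    cube : ∀ x → (x * x + 3· x + 3· 1#) * x + 1# ≈ (x + 1#) * ((x + 1#) * ((x + 1#) * 1#))
    cube = solve 1 (λ x → (x :* x :+ (x :+ x :+ x) :+ (con 1 :+ con 1 :+ con 1)) :* x :+ con 1
                       := (x :+ con 1) :* ((x :+ con 1) :* ((x :+ con 1) :* con 1))) CR.refl

    eq : (a * a + 3· a + 3· 1#) * a + 1# ≈ 1# + 1#
    eq = begin
      (a * a + 3· a + 3· 1#) * a + 1#               ≈⟨ cube a ⟩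
      (a + 1#) * ((a + 1#) * ((a + 1#) * 1#))       ≈⟨ *-cong a+1≈c₀ (*-cong a+1≈c₀ (*-congʳ a+1≈c₀)) ⟩
      c₀ * (c₀ * (c₀ * 1#))                         ≈⟨ root-^ 3 _ _ ⟩
      1# + (1# + 0#)                                ≈⟨ +-congˡ (+-identityʳ 1#) ⟩
      1# + 1#                                       ∎

  S : (k ε : ℤ) (B : ℝ) (d z : ℤ) → Set ℓ₂
  S k ε B d z =
      (ι d / α [ α#0 ] <ᴿ ι (+ ∣ z ∣) × ι (+ ∣ z ∣) ≤ᴿ B)
    × sgn z ≡ ε ℤ.* legendre₃ d
    × z ℤ.^ 3 ≋ k [mod d ]
    × IsSquare (+ 3 ℤ.* d ℤ.* (+ 4 ℤ.* ε ℤ.* legendre₃ d ℤ.* (z ℤ.^ 3 ℤ.- k) ℤ.- d ℤ.^ 3))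

  3d>0 : ∀ {d} → 0ℤ ℤ.< d → 0ℤ ℤ.< + 3 ℤ.* d
  3d>0 {d} d>0 = ℤ.*-monoˡ-<-pos (+ 3) d>0

  radicand : (k z d : ℤ) → 0ℤ ℤ.< d → ℝ
  radicand k z d d>0 =
    ι (+ 4 ℤ.* + ∣ k ℤ.- z ℤ.^ 3 ∣ ℤ.- d ℤ.^ 3) / ι (+ 3 ℤ.* d) [ ι-#0 (3d>0 d>0) ]

  ½ : ℝ
  ½ = 1# / ι (+ 2) [ ι-#0 2>0 ]

  value₊ value₋ : (k z d : ℤ) (d>0 : 0ℤ ℤ.< d) → radicand k z d d>0 ≥ᴿ0 → ℝ
  value₊ k z d d>0 r≥0 =
    ½ *ᴿ ι (sgn (k ℤ.- z ℤ.^ 3)) *ᴿ (ι d +ᴿ √ (radicand k z d d>0) r≥0)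
  value₋ k z d d>0 r≥0 =
    ½ *ᴿ ι (sgn (k ℤ.- z ℤ.^ 3)) *ᴿ (ι d -ᴿ √ (radicand k z d d>0) r≥0)

  ⟅_,_⟆ : ℝ → ℝ → Pred ℝ ℓ₁
  ⟅ a , b ⟆ t = t ≈ a ⊎ t ≈ b

module Submission where

-- Let (x, y, z) be a solution as in (a).  Since |z|³ > k, the two smaller
-- summands must have the sign opposite to that of x (sign-pattern): with a
-- sign s one has x = s X, y = - s Y, z = - s Z for naturals X > Y > Z, and
-- d = |x + y| = X - Y.  Then k - z³ = x³ + y³ = s d (X² + X Y + Y²), so s is the
-- sign of k - z³, d divides z³ - k, and
--   4 |k - z³| - d³ = 3 d (X + Y)²,
-- so that the root in the formula is X + Y and the formula merely expresses X
-- and - Y as half the sum and half the difference of d and X + Y.  Modulo 9 the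
-- sum of three cubes can be 3 ε only if x ≡ y ≡ z ≡ ε modulo 3 (cubes-mod-9);
-- hence s d = x + y ≡ - ε, which gives (d/3) = - s ε = ε sgn z.
--
-- The bound d < α |z| amounts to (d + Z)³ < 2 Z³.  This is compared with
-- (d + Y)³ - Y³ = Z³ + s k < Z³ + Z², the discrepancy Z² being compensated by
-- Y ≥ Z + 1 unless d < Z / 4, in which case the bound is clear (cube-bound).
-- The remaining bound d < α B follows from |z| ≤ B.
--
-- For (b), write the square of the fourth condition as n² = 3 d² (4 m - d²),
-- where d m = ε (d/3) (z³ - k).  Then n = 3 d t with 3 t² = 4 m - d²; thus m > 0,
-- t ≡ d modulo 2, the root in the formula is |t|, and
--   x³ + y³ = s d (d² + 3 t²) / 4 = s d m = k - z³   with   s = sgn (k - z³)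
-- (square⇒solution).
--
-- All of this is integer arithmetic.  The real numbers, whose order is not
-- assumed decidable, enter only through the embedding ι of the integers, the
-- uniqueness of nonnegative square roots, and the positivity of α.

open import Defs
open import Data.Nat.Base as ℕ using (ℕ; zero; suc) renaming (_≥_ to _≥ℕ_)
import Data.Nat.Properties as ℕ
import Data.Nat.DivMod as ℕ
import Data.Nat.Divisibility as ℕ
import Data.Nat.GCD as ℕ
import Data.Nat.Solver as ℕ
open import Data.Nat.Coprimality using (Coprime; coprime⇒gcd≡1; coprime-divisor; coprime-/gcd)
open import Data.Nat.Primality using (Prime; prime?; euclidsLemma)
open import Data.Fin.Base using (Fin; toℕ; fromℕ<)
import Data.Fin.Properties as Fin
open import Data.Integer.Base
  using (ℤ; +_; -[1+_]; +[1+_]; -_; ∣_∣; 0ℤ; 1ℤ; -1ℤ; _+_; _-_; _*_; _^_; _<_; _≤_; _⊖_;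
         +<+; +≤+; _%ℕ_; _/ℕ_)
import Data.Integer.Properties as ℤ
import Data.Integer.DivMod as ℤ
import Data.Integer.Divisibility.Signed as ℤ
open import Data.Integer.Divisibility.Signed using (divides) renaming (_∣_ to _∣ˢ_)
import Data.Integer.Solver as ℤ
open import Data.Integer.Tactic.RingSolver using (solve-∀)
open import Data.Integer.GCD using (gcd)
open import Data.Product.Base using (Σ-syntax; ∃-syntax; _×_; _,_; proj₁; proj₂)
open import Data.Sum.Base as Sum using (_⊎_; inj₁; inj₂; [_,_]′)
open import Data.Maybe.Base as Maybe using ()
open import Function.Base using (_∘_; id)
open import Relation.Nullary.Negation using (¬_; contradiction)
open import Relation.Nullary.Decidable using (Dec; yes; no; from-yes; from-no; dec⇒maybe; _→-dec_)
open import Relation.Unary using (_≐_)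
open import Relation.Binary.Structures using (IsStrictPartialOrder)
open import Relation.Binary.PropositionalEquality as ≡
  using (_≡_; _≢_; refl; sym; trans; cong; cong₂; subst; module ≡-Reasoning)
open import Algebra.Bundles using (CommutativeRing)
open import Algebra.Solver.Ring.AlmostCommutativeRing
  using (fromCommutativeRing; _-Raw-AlmostCommutative⟶_)
import Algebra.Solver.Ring as RingSolver
import Algebra.Properties.Semiring.Mult as SemiringMult
import Algebra.Properties.Ring as RingProperties
import Algebra.Apartness.Properties.HeytingCommutativeRing as HeytingProperties
import Relation.Binary.Reasoning.Setoid as ≈-Reasoning

-- Inequalities between cubes of natural numbers

-- A hypothesis k < n² also excludes n = 0.
k<n²⇒k<n³ : ∀ {k} n → k ℕ.< n ℕ.* n → k ℕ.< n ℕ.^ 3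
k<n²⇒k<n³ n@(suc _) k<n² = ℕ.<-≤-trans k<n² (ℕ.*-monoʳ-≤ n (ℕ.m≤m*n n (n ℕ.* 1)))

y<x-of-cubes : ∀ {k x y z} → y ℕ.^ 3 ℕ.+ z ℕ.^ 3 ℕ.≤ x ℕ.^ 3 ℕ.+ k → k ℕ.< z ℕ.* z → y ℕ.< x
y<x-of-cubes {k} {x} {y} {z} y³+z³≤x³+k k<z² = ℕ.≰⇒> λ x≤y →
  ℕ.<⇒≱ (k<n²⇒k<n³ z k<z²)
    (ℕ.+-cancelˡ-≤ (y ℕ.^ 3) _ _ (ℕ.≤-trans y³+z³≤x³+k (ℕ.+-monoˡ-≤ k (ℕ.^-monoˡ-≤ 3 x≤y))))

-- The inequality behind d / α < |z|, where x = y + d.  If 4 d < z, then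
-- (d + z)³ ≤ (5/4)³ z³ < 2 z³ outright.  Otherwise z² ≤ 4 d z, and the
-- monotonicity in y of (y + d)³ - y³, from z up to y ≥ z + 1, gains at
-- least 4 d z; this absorbs k < z².
cube-bound : ∀ {k y z d} → z ℕ.< y → k ℕ.< z ℕ.* z →
  (y ℕ.+ d) ℕ.^ 3 ℕ.≤ y ℕ.^ 3 ℕ.+ z ℕ.^ 3 ℕ.+ k → (d ℕ.+ z) ℕ.^ 3 ℕ.< 2 ℕ.* z ℕ.^ 3
cube-bound {k} {y} {z} {d} z<y k<z² x³≤ with z ℕ.≤? 4 ℕ.* d
... | no z≰4d with ℕ.m≤n⇒∃[o]m+o≡n (ℕ.≰⇒> z≰4d)
...   | f , refl = subst ((d ℕ.+ z) ℕ.^ 3 ℕ.<_) (expand d f)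
        (ℕ.m<m+n _ (ℕ.<-≤-trans (ℕ.m^n>0 (suc f) 3) (ℕ.m≤m+n _ _)))
  where
  open ℕ.+-*-Solver
  expand : ∀ d f → let z = suc (4 ℕ.* d) ℕ.+ f; w = suc f in
    (d ℕ.+ z) ℕ.^ 3 ℕ.+ (w ℕ.^ 3 ℕ.+ (3 ℕ.* d ℕ.^ 3 ℕ.+ 21 ℕ.* (d ℕ.* d ℕ.* w) ℕ.+ 9 ℕ.* (d ℕ.* w ℕ.* w)))
      ≡ 2 ℕ.* z ℕ.^ 3
  expand = solve 2 (λ d f →
    let z = con 1 :+ con 4 :* d :+ f; w = con 1 :+ f in
    (d :+ z) :^ 3 :+ (w :^ 3 :+ (con 3 :* d :^ 3 :+ con 21 :* (d :* d :* w) :+ con 9 :* (d :* w :* w)))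
      := con 2 :* z :^ 3) refl
cube-bound {k} {y} {z} {d} z<y k<z² x³≤ | yes z≤4d with ℕ.m≤n⇒∃[o]m+o≡n z<y
... | e , refl = ℕ.+-cancelʳ-< k _ _ (ℕ.+-cancelˡ-< (y ℕ.^ 3) _ _ (begin-strict
  y ℕ.^ 3 ℕ.+ ((d ℕ.+ z) ℕ.^ 3 ℕ.+ k)              <⟨ ℕ.+-monoʳ-< (y ℕ.^ 3) (ℕ.+-monoʳ-< ((d ℕ.+ z) ℕ.^ 3) k<z²) ⟩
  y ℕ.^ 3 ℕ.+ ((d ℕ.+ z) ℕ.^ 3 ℕ.+ z ℕ.* z)        ≤⟨ ℕ.+-monoʳ-≤ (y ℕ.^ 3) (ℕ.+-monoʳ-≤ ((d ℕ.+ z) ℕ.^ 3) (ℕ.*-monoˡ-≤ z z≤4d)) ⟩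
  y ℕ.^ 3 ℕ.+ ((d ℕ.+ z) ℕ.^ 3 ℕ.+ 4 ℕ.* d ℕ.* z)  ≤⟨ ℕ.m≤m+n _ _ ⟩
  _                                                ≡⟨ expand z d e ⟩
  z ℕ.^ 3 ℕ.+ (y ℕ.+ d) ℕ.^ 3                      ≤⟨ ℕ.+-monoʳ-≤ (z ℕ.^ 3) x³≤ ⟩
  z ℕ.^ 3 ℕ.+ (y ℕ.^ 3 ℕ.+ z ℕ.^ 3 ℕ.+ k)          ≡⟨ regroup (z ℕ.^ 3) (y ℕ.^ 3) k ⟩
  y ℕ.^ 3 ℕ.+ (2 ℕ.* z ℕ.^ 3 ℕ.+ k)                ∎))
  where
  open ℕ.≤-Reasoning
  open ℕ.+-*-Solver
  regroup : ∀ c b k → c ℕ.+ (b ℕ.+ c ℕ.+ k) ≡ b ℕ.+ (2 ℕ.* c ℕ.+ k)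
  regroup = solve 3 (λ c b k → c :+ (b :+ c :+ k) := b :+ (con 2 :* c :+ k)) refl
  expand : ∀ z d e → let y = suc z ℕ.+ e in
    y ℕ.^ 3 ℕ.+ ((d ℕ.+ z) ℕ.^ 3 ℕ.+ 4 ℕ.* d ℕ.* z)
      ℕ.+ (2 ℕ.* (z ℕ.* d) ℕ.+ 6 ℕ.* (z ℕ.* e ℕ.* d) ℕ.+ 3 ℕ.* ((1 ℕ.+ e) ℕ.* (1 ℕ.+ e) ℕ.* d) ℕ.+ 3 ℕ.* ((1 ℕ.+ e) ℕ.* d ℕ.* d))
      ≡ z ℕ.^ 3 ℕ.+ (y ℕ.+ d) ℕ.^ 3
  expand = solve 3 (λ z d e → let y = con 1 :+ z :+ e; u = con 1 :+ e in
    y :^ 3 :+ ((d :+ z) :^ 3 :+ con 4 :* d :* z)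
      :+ (con 2 :* (z :* d) :+ con 6 :* (z :* e :* d) :+ con 3 :* (u :* u :* d) :+ con 3 :* (u :* d :* d))
      := z :^ 3 :+ (y :+ d) :^ 3) refl

-- Divisibility and primes

a²∣b²⇒a∣b : ∀ a b .{{_ : ℕ.NonZero a}} → a ℕ.* a ℕ.∣ b ℕ.* b → a ℕ.∣ b
a²∣b²⇒a∣b a b a²∣b² = subst (ℕ._∣ b) (sym a≡g) (ℕ.gcd[m,n]∣n a b)
  where
  open ≡-Reasoning
  g = ℕ.gcd a b
  instance
    g≢0 : ℕ.NonZero g
    g≢0 = ℕ.≢-nonZero (ℕ.gcd[m,n]≢0 a b (inj₁ (ℕ.≢-nonZero⁻¹ a)))
  a′ = a ℕ./ g
  b′ = b ℕ./ g

  split : ∀ {n} → g ℕ.∣ n → n ℕ.* n ≡ (n ℕ./ g) ℕ.* (n ℕ./ g) ℕ.* (g ℕ.* g)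
  split {n} g∣n = trans (cong (λ m → m ℕ.* m) (sym (ℕ.m/n*n≡m g∣n)))
    (ℕ.[m*n]*[o*p]≡[m*o]*[n*p] (n ℕ./ g) g (n ℕ./ g) g)

  a′²∣b′² : a′ ℕ.* a′ ℕ.∣ b′ ℕ.* b′
  a′²∣b′² = ℕ.*-cancelʳ-∣ (g ℕ.* g) {{ℕ.m*n≢0 g g}}
    (≡.subst₂ ℕ._∣_ (split (ℕ.gcd[m,n]∣m a b)) (split (ℕ.gcd[m,n]∣n a b)) a²∣b²)

  coprime : Coprime a′ b′
  coprime = coprime-/gcd a b

  a′≡1 : a′ ≡ 1
  a′≡1 = coprime (ℕ.∣-refl , coprime-divisor coprime (ℕ.∣-trans (ℕ.m∣m*n a′) a′²∣b′²))

  a≡g : a ≡ g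
  a≡g = begin
    a          ≡⟨ ℕ.m/n*n≡m (ℕ.gcd[m,n]∣m a b) ⟨
    a′ ℕ.* g   ≡⟨ cong (ℕ._* g) a′≡1 ⟩
    1 ℕ.* g    ≡⟨ ℕ.*-identityˡ g ⟩
    g          ∎

prime∣i²⇒prime∣i : ∀ {p} i → Prime p → + p ∣ˢ i * i → + p ∣ˢ i
prime∣i²⇒prime∣i {p} i p-prime p∣i² = ℤ.∣ᵤ⇒∣ ([ id , id ]′
  (euclidsLemma ∣ i ∣ ∣ i ∣ p-prime (subst (p ℕ.∣_) (ℤ.abs-* i i) (ℤ.∣⇒∣ᵤ p∣i²))))

i²≡∣i∣² : ∀ i → i * i ≡ + ∣ i ∣ * + ∣ i ∣
i²≡∣i∣² (+ n)    = refl
i²≡∣i∣² -[1+ n ] = refl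

-- Signs and cubes of integers

-- A sign: one of the two units of the integers.
IsUnit : ℤ → Set
IsUnit s = s ≡ 1ℤ ⊎ s ≡ -1ℤ

unit²*i≡i : ∀ {s} i → IsUnit s → s * s * i ≡ i
unit²*i≡i i (inj₁ refl) = ℤ.*-identityˡ i
unit²*i≡i i (inj₂ refl) = ℤ.*-identityˡ i

unit-* : ∀ {s u} → IsUnit s → IsUnit u → IsUnit (s * u)
unit-* (inj₁ refl) (inj₁ refl) = inj₁ refl
unit-* (inj₁ refl) (inj₂ refl) = inj₂ refl
unit-* (inj₂ refl) (inj₁ refl) = inj₂ refl
unit-* (inj₂ refl) (inj₂ refl) = inj₁ refl

unit-neg : ∀ {s} → IsUnit s → IsUnit (- s)
unit-neg (inj₁ refl) = inj₂ refl
unit-neg (inj₂ refl) = inj₁ refl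

∣unit*n∣ : ∀ {s} n → IsUnit s → ∣ s * + n ∣ ≡ n
∣unit*n∣ n (inj₁ refl) = cong ∣_∣ (ℤ.*-identityˡ (+ n))
∣unit*n∣ n (inj₂ refl) = trans (cong ∣_∣ (ℤ.-1*i≡-i (+ n))) (ℤ.∣-i∣≡∣i∣ (+ n))

∣unit*pos∣ : ∀ {s i} → IsUnit s → 0ℤ < i → + ∣ s * i ∣ ≡ i
∣unit*pos∣ {i = + n} unit _ = cong +_ (∣unit*n∣ n unit)

sgn-unit*pos : ∀ {s i} → IsUnit s → 0ℤ < i → sgn (s * i) ≡ s
sgn-unit*pos {i = +[1+ n ]} (inj₁ refl) _ = cong sgn (ℤ.*-identityˡ +[1+ n ])
sgn-unit*pos {i = +[1+ n ]} (inj₂ refl) _ = cong sgn (ℤ.-1*i≡-i +[1+ n ])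
sgn-unit*pos {i = + 0}      _ (+<+ ())

pos-cube : ∀ n → (+ n) ^ 3 ≡ + (n ℕ.^ 3)
pos-cube n = trans (cong (λ i → + n * (+ n * i)) (sym (ℤ.pos-* n 1)))
  (trans (cong (λ i → + n * i) (sym (ℤ.pos-* n (n ℕ.* 1)))) (sym (ℤ.pos-* n (n ℕ.* (n ℕ.* 1)))))

neg-cube : ∀ i → (- i) ^ 3 ≡ - (i ^ 3)
neg-cube = solve 1 (λ i → (:- i) :^ 3 := :- (i :^ 3)) refl
  where open ℤ.+-*-Solver

pos-cube-mono : ∀ {m n} → m ℕ.≤ n → (+ m) ^ 3 ≤ (+ n) ^ 3
pos-cube-mono {m} {n} m≤n = ≡.subst₂ _≤_ (sym (pos-cube m)) (sym (pos-cube n)) (+≤+ (ℕ.^-monoˡ-≤ 3 m≤n))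

-- If the summand of largest absolute value is nonnegative, the other two are
-- negative: any other choice of signs makes the sum at least |z|³ > k.
opposite-signs : ∀ {k} x y z → ∣ y ∣ ℕ.≤ x → ∣ z ∣ ℕ.≤ ∣ y ∣ →
  (+ x) ^ 3 + y ^ 3 + z ^ 3 ≤ + k → k ℕ.< ∣ z ∣ ℕ.* ∣ z ∣ →
  y ≡ - + ∣ y ∣ × z ≡ - + ∣ z ∣
opposite-signs {k} x y z y≤x z≤y sum≤k k<z² = signs y z y≤x z≤y sum≤k λ z³≤k →
    ℕ.<⇒≱ (k<n²⇒k<n³ ∣ z ∣ k<z²) (ℤ.drop‿+≤+ (subst (_≤ + k) (pos-cube ∣ z ∣) z³≤k))
  where
  0≤cube : ∀ n → 0ℤ ≤ (+ n) ^ 3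
  0≤cube n = subst (0ℤ ≤_) (sym (pos-cube n)) (+≤+ ℕ.z≤n)

  0≤difference : ∀ {m n} → m ℕ.≤ n → 0ℤ ≤ (+ n) ^ 3 - (+ m) ^ 3
  0≤difference m≤n = ℤ.i≤j⇒0≤j-i (pos-cube-mono m≤n)

  -- In each of the three cases, the left side minus z³ is a sum of two
  -- nonnegative terms.
  case₁ : ∀ a b c → a + b + c - c ≡ a + b
  case₁ = solve-∀

  case₂ : ∀ a b c → a + b + - c - c ≡ (a - c) + (b - c)
  case₂ = solve-∀

  case₃ : ∀ a b c → a + - b + c - c ≡ (a - b) + 0ℤ
  case₃ = solve-∀

  conclude : ∀ {c w u v} → w - c ≡ u + v → 0ℤ ≤ u → 0ℤ ≤ v → w ≤ + k → c ≤ + k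
  conclude w-c≡u+v 0≤u 0≤v w≤k =
    ℤ.≤-trans (ℤ.0≤i-j⇒j≤i (subst (0ℤ ≤_) (sym w-c≡u+v) (ℤ.+-mono-≤ 0≤u 0≤v))) w≤k

  signs : ∀ y z → ∣ y ∣ ℕ.≤ x → ∣ z ∣ ℕ.≤ ∣ y ∣ → (+ x) ^ 3 + y ^ 3 + z ^ 3 ≤ + k →
    ¬ ((+ ∣ z ∣) ^ 3 ≤ + k) → y ≡ - + ∣ y ∣ × z ≡ - + ∣ z ∣
  signs -[1+ _ ] -[1+ _ ] _ _ _ _ = refl , refl
  signs (+ y) (+ z) y≤x z≤y sum≤k z³≰k = contradiction
    (conclude (case₁ ((+ x) ^ 3) ((+ y) ^ 3) ((+ z) ^ 3)) (0≤cube x) (0≤cube y) sum≤k) z³≰k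
  signs (+ y) -[1+ n ] y≤x z≤y sum≤k z³≰k = contradiction
    (conclude (case₂ ((+ x) ^ 3) ((+ y) ^ 3) ((+ suc n) ^ 3))
      (0≤difference (ℕ.≤-trans z≤y y≤x)) (0≤difference z≤y)
      (subst (λ i → (+ x) ^ 3 + (+ y) ^ 3 + i ≤ + k) (neg-cube (+ suc n)) sum≤k)) z³≰k
  signs -[1+ n ] (+ z) y≤x z≤y sum≤k z³≰k = contradiction
    (conclude (case₃ ((+ x) ^ 3) ((+ suc n) ^ 3) ((+ z) ^ 3)) (0≤difference y≤x) (+≤+ ℕ.z≤n)
      (subst (λ i → (+ x) ^ 3 + i + (+ z) ^ 3 ≤ + k) (neg-cube (+ suc n)) sum≤k)) z³≰k

-- The same without the assumption on the sign of x: the signs are (s, -s, -s).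
sign-pattern : ∀ {k} x y z → ∣ y ∣ ℕ.≤ ∣ x ∣ → ∣ z ∣ ℕ.≤ ∣ y ∣ →
  x ^ 3 + y ^ 3 + z ^ 3 ≡ + k → k ℕ.< ∣ z ∣ ℕ.* ∣ z ∣ →
  ∃[ s ] IsUnit s × x ≡ s * + ∣ x ∣ × y ≡ s * - + ∣ y ∣ × z ≡ s * - + ∣ z ∣
sign-pattern (+ x) y z y≤x z≤y sum≡k k<z²
  with opposite-signs x y z y≤x z≤y (ℤ.≤-reflexive sum≡k) k<z²
... | y≡ , z≡ = 1ℤ , inj₁ refl , sym (ℤ.*-identityˡ _) ,
      trans y≡ (sym (ℤ.*-identityˡ _)) , trans z≡ (sym (ℤ.*-identityˡ _))
sign-pattern {k} x@(-[1+ n ]) y z y≤x z≤y sum≡k k<z²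
  with opposite-signs {k} (suc n) (- y) (- z)
    (≡.subst₂ ℕ._≤_ (sym (ℤ.∣-i∣≡∣i∣ y)) refl y≤x)
    (≡.subst₂ ℕ._≤_ (sym (ℤ.∣-i∣≡∣i∣ z)) (sym (ℤ.∣-i∣≡∣i∣ y)) z≤y)
    (subst (_≤ + k) (sym negated-sum) (ℤ.neg-≤-pos {k} {k}))
    (subst (λ i → k ℕ.< i ℕ.* i) (sym (ℤ.∣-i∣≡∣i∣ z)) k<z²)
  where
  neg-sum : ∀ x y z → (- x) ^ 3 + (- y) ^ 3 + (- z) ^ 3 ≡ - (x ^ 3 + y ^ 3 + z ^ 3)
  neg-sum = solve 3 (λ x y z → (:- x) :^ 3 :+ (:- y) :^ 3 :+ (:- z) :^ 3
                       := :- (x :^ 3 :+ y :^ 3 :+ z :^ 3)) refl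
    where open ℤ.+-*-Solver
  negated-sum : (- x) ^ 3 + (- y) ^ 3 + (- z) ^ 3 ≡ - + k
  negated-sum = trans (neg-sum x y z) (cong -_ sum≡k)
... | -y≡ , -z≡ = -1ℤ , inj₂ refl , sym (ℤ.-1*i≡-i (+ suc n)) , unnegate y -y≡ , unnegate z -z≡
  where
  unnegate : ∀ i → - i ≡ - + ∣ - i ∣ → i ≡ -1ℤ * - + ∣ i ∣
  unnegate i -i≡ = begin
    i                ≡⟨ ℤ.neg-involutive i ⟨
    - - i            ≡⟨ cong -_ -i≡ ⟩
    - - + ∣ - i ∣    ≡⟨ cong (λ n → - - + n) (ℤ.∣-i∣≡∣i∣ i) ⟩
    - - + ∣ i ∣      ≡⟨ ℤ.-1*i≡-i (- + ∣ i ∣) ⟨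
    -1ℤ * - + ∣ i ∣  ∎
    where open ≡-Reasoning

-- What remains of x³ = y³ + z³ + s k when only s = ± 1 is known.
cube-inequalities : ∀ {s x y z k} → IsUnit s →
  (s * + x) ^ 3 + (s * - + y) ^ 3 + (s * - + z) ^ 3 ≡ + k →
  x ℕ.^ 3 ℕ.≤ y ℕ.^ 3 ℕ.+ z ℕ.^ 3 ℕ.+ k × y ℕ.^ 3 ℕ.+ z ℕ.^ 3 ℕ.≤ x ℕ.^ 3 ℕ.+ k
cube-inequalities {s} {x} {y} {z} {k} = cases
  where
  open ≡-Reasoning
  open ℤ.+-*-Solver using (solve; _:=_; _:+_; _:-_; _:*_; _:^_; :-_; con)

  expand₊ : ∀ x y z → (1ℤ * x) ^ 3 + (1ℤ * - y) ^ 3 + (1ℤ * - z) ^ 3 ≡ x ^ 3 - (y ^ 3 + z ^ 3)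
  expand₊ = solve 3 (λ x y z → (con 1ℤ :* x) :^ 3 :+ (con 1ℤ :* :- y) :^ 3 :+ (con 1ℤ :* :- z) :^ 3
                       := x :^ 3 :- (y :^ 3 :+ z :^ 3)) refl

  expand₋ : ∀ x y z → (-1ℤ * x) ^ 3 + (-1ℤ * - y) ^ 3 + (-1ℤ * - z) ^ 3 ≡ (y ^ 3 + z ^ 3) - x ^ 3
  expand₋ = solve 3 (λ x y z → (con -1ℤ :* x) :^ 3 :+ (con -1ℤ :* :- y) :^ 3 :+ (con -1ℤ :* :- z) :^ 3
                       := (y :^ 3 :+ z :^ 3) :- x :^ 3) refl

  i≡j+[i-j] : ∀ i j → i ≡ j + (i - j)
  i≡j+[i-j] = solve-∀

  pos-sum : (+ y) ^ 3 + (+ z) ^ 3 ≡ + (y ℕ.^ 3 ℕ.+ z ℕ.^ 3)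
  pos-sum = cong₂ _+_ (pos-cube y) (pos-cube z)

  cases : IsUnit s → (s * + x) ^ 3 + (s * - + y) ^ 3 + (s * - + z) ^ 3 ≡ + k →
    x ℕ.^ 3 ℕ.≤ y ℕ.^ 3 ℕ.+ z ℕ.^ 3 ℕ.+ k × y ℕ.^ 3 ℕ.+ z ℕ.^ 3 ℕ.≤ x ℕ.^ 3 ℕ.+ k
  cases (inj₁ refl) sum≡k =
    ℕ.≤-reflexive x³≡ , ℕ.≤-trans (ℕ.m≤m+n _ k) (ℕ.≤-trans (ℕ.≤-reflexive (sym x³≡)) (ℕ.m≤m+n _ k))
    where
    x³≡ : x ℕ.^ 3 ≡ y ℕ.^ 3 ℕ.+ z ℕ.^ 3 ℕ.+ k
    x³≡ = ℤ.+-injective (begin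
      + (x ℕ.^ 3)                                            ≡⟨ pos-cube x ⟨
      (+ x) ^ 3                                              ≡⟨ i≡j+[i-j] ((+ x) ^ 3) ((+ y) ^ 3 + (+ z) ^ 3) ⟩
      (+ y) ^ 3 + (+ z) ^ 3 + ((+ x) ^ 3 - ((+ y) ^ 3 + (+ z) ^ 3))
                                                             ≡⟨ cong₂ _+_ pos-sum (trans (sym (expand₊ (+ x) (+ y) (+ z))) sum≡k) ⟩
      + (y ℕ.^ 3 ℕ.+ z ℕ.^ 3 ℕ.+ k)                          ∎)
  cases (inj₂ refl) sum≡k =
    ℕ.≤-trans (ℕ.m≤m+n _ k) (ℕ.≤-trans (ℕ.≤-reflexive (sym y³+z³≡)) (ℕ.m≤m+n _ k)) , ℕ.≤-reflexive y³+z³≡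
    where
    y³+z³≡ : y ℕ.^ 3 ℕ.+ z ℕ.^ 3 ≡ x ℕ.^ 3 ℕ.+ k
    y³+z³≡ = ℤ.+-injective (begin
      + (y ℕ.^ 3 ℕ.+ z ℕ.^ 3)                          ≡⟨ pos-sum ⟨
      (+ y) ^ 3 + (+ z) ^ 3                            ≡⟨ i≡j+[i-j] ((+ y) ^ 3 + (+ z) ^ 3) ((+ x) ^ 3) ⟩
      (+ x) ^ 3 + ((+ y) ^ 3 + (+ z) ^ 3 - (+ x) ^ 3)  ≡⟨ cong₂ _+_ (pos-cube x) (trans (sym (expand₋ (+ x) (+ y) (+ z))) sum≡k) ⟩
      + (x ℕ.^ 3 ℕ.+ k)                                ∎)

-- Residues modulo 3 and 9

residue₃ : ∀ i → ∃[ r ] ∃[ q ] i ≡ + toℕ {3} r + q * + 3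
residue₃ i = fromℕ< (ℤ.n%ℕd<d i 3) , i /ℕ 3 ,
  trans (ℤ.a≡a%ℕn+[a/ℕn]*n i 3) (cong (λ r → + r + i /ℕ 3 * + 3) (sym (Fin.toℕ-fromℕ< _)))

-- Cubes are 0 or ±1 modulo 9, so three of them sum to 3 ε only if each is
-- congruent to ε; the bases are then congruent to ε modulo 3, and
-- a + b ≡ 2 ε ≡ - ε.  Established by checking all residues.
cubes-mod-9 : ∀ {ε} → IsUnit ε → ∀ (a b c : Fin 3) →
  9 ℕ.∣ ∣ (+ toℕ a) ^ 3 + (+ toℕ b) ^ 3 + (+ toℕ c) ^ 3 - + 3 * ε ∣ →
  3 ℕ.∣ ∣ + toℕ a + + toℕ b + ε ∣
cubes-mod-9 {ε} unit = check unit
  where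
  decide : ∀ ε → Dec (∀ (a b c : Fin 3) →
    9 ℕ.∣ ∣ (+ toℕ a) ^ 3 + (+ toℕ b) ^ 3 + (+ toℕ c) ^ 3 - + 3 * ε ∣ →
    3 ℕ.∣ ∣ + toℕ a + + toℕ b + ε ∣)
  decide ε = Fin.all? λ a → Fin.all? λ b → Fin.all? λ c →
    (9 ℕ.∣? ∣ (+ toℕ a) ^ 3 + (+ toℕ b) ^ 3 + (+ toℕ c) ^ 3 - + 3 * ε ∣)
      →-dec (3 ℕ.∣? ∣ + toℕ a + + toℕ b + ε ∣)

  check : ∀ {ε} → IsUnit ε → ∀ (a b c : Fin 3) →
    9 ℕ.∣ ∣ (+ toℕ a) ^ 3 + (+ toℕ b) ^ 3 + (+ toℕ c) ^ 3 - + 3 * ε ∣ →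
    3 ℕ.∣ ∣ + toℕ a + + toℕ b + ε ∣
  check (inj₁ refl) = from-yes (decide 1ℤ)
  check (inj₂ refl) = from-yes (decide -1ℤ)

sum-mod-3 : ∀ {k ε} x y z → IsUnit ε → x ^ 3 + y ^ 3 + z ^ 3 ≡ k → k ≋ + 3 * ε [mod + 9 ] →
  + 3 ∣ˢ x + y + ε
sum-mod-3 {k} {ε} x y z unit refl k≋3ε with residue₃ x | residue₃ y | residue₃ z
... | a , p , refl | b , q , refl | c , r , refl =
  subst (+ 3 ∣ˢ_) (shift (+ toℕ a) (+ toℕ b) ε p q)
    (ℤ.∣m∣n⇒∣m+n
      (ℤ.∣ᵤ⇒∣ {+ 3} {+ toℕ a + + toℕ b + ε} (cubes-mod-9 unit a b c (ℤ.∣⇒∣ᵤ 9∣residues)))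
      (divides (p + q) refl))
  where
  open ℤ.+-*-Solver using (solve; _:=_; _:+_; _:-_; _:*_; _:^_; :-_; con)
  shift : ∀ a b ε p q → a + b + ε + (p + q) * + 3 ≡ (a + p * + 3) + (b + q * + 3) + ε
  shift = solve-∀

  -- (a + 3 p)³ - a³ = 9 (a² p + 3 a p² + 3 p³)
  term : ℤ → ℤ → ℤ
  term a p = a * a * p + + 3 * a * p * p + + 3 * p * p * p

  cofactor : ℤ
  cofactor = term (+ toℕ a) p + term (+ toℕ b) q + term (+ toℕ c) r

  cube-shift : ∀ a b c ε p q r →
    (a + p * + 3) ^ 3 + (b + q * + 3) ^ 3 + (c + r * + 3) ^ 3 - + 3 * ε
      ≡ (a ^ 3 + b ^ 3 + c ^ 3 - + 3 * ε)
        + (term a p + term b q + term c r) * + 9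
  cube-shift = solve 7 (λ a b c ε p q r →
    let g = λ a p → a :* a :* p :+ con (+ 3) :* a :* p :* p :+ con (+ 3) :* p :* p :* p in
    (a :+ p :* con (+ 3)) :^ 3 :+ (b :+ q :* con (+ 3)) :^ 3 :+ (c :+ r :* con (+ 3)) :^ 3 :- con (+ 3) :* ε
      := (a :^ 3 :+ b :^ 3 :+ c :^ 3 :- con (+ 3) :* ε) :+ (g a p :+ g b q :+ g c r) :* con (+ 9)) refl

  9∣residues : + 9 ∣ˢ (+ toℕ a) ^ 3 + (+ toℕ b) ^ 3 + (+ toℕ c) ^ 3 - + 3 * ε
  9∣residues = ℤ.∣m+n∣n⇒∣m
    (subst (+ 9 ∣ˢ_) (cube-shift (+ toℕ a) (+ toℕ b) (+ toℕ c) ε p q r) (ℤ.∣ᵤ⇒∣ {+ 9} k≋3ε))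
    (ℤ.∣n⇒∣m*n cofactor ℤ.∣-refl)

legendre₃-range : ∀ d → legendre₃ d ≡ 0ℤ ⊎ IsUnit (legendre₃ d)
legendre₃-range d with d %ℕ 3
... | 0           = inj₁ refl
... | 1           = inj₂ (inj₁ refl)
... | suc (suc _) = inj₂ (inj₂ refl)

legendre₃-cong : ∀ d → + 3 ∣ˢ d - legendre₃ d
legendre₃-cong d with d %ℕ 3 | d /ℕ 3 | ℤ.a≡a%ℕn+[a/ℕn]*n d 3 | ℤ.n%ℕd<d d 3
... | 0 | q | refl | _ = divides q (eq q)
  where
  eq : ∀ q → 0ℤ + q * + 3 - 0ℤ ≡ q * + 3
  eq = solve-∀
... | 1 | q | refl | _ = divides q (eq q)
  where
  eq : ∀ q → 1ℤ + q * + 3 - 1ℤ ≡ q * + 3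
  eq = solve-∀
... | 2 | q | refl | _ = divides (q + 1ℤ) (eq q)
  where
  eq : ∀ q → + 2 + q * + 3 - -1ℤ ≡ (q + 1ℤ) * + 3
  eq = solve-∀
... | suc (suc (suc _)) | _ | _ | ℕ.s≤s (ℕ.s≤s (ℕ.s≤s ()))

-- The elements of {0, 1, -1} are incongruent modulo 3.
unit-unique-mod-3 : ∀ {L u} → L ≡ 0ℤ ⊎ IsUnit L → IsUnit u → + 3 ∣ˢ L - u → L ≡ u
unit-unique-mod-3 (inj₁ refl) (inj₁ refl) 3∣ = contradiction (ℤ.∣⇒∣ᵤ 3∣) (from-no (3 ℕ.∣? 1))
unit-unique-mod-3 (inj₁ refl) (inj₂ refl) 3∣ = contradiction (ℤ.∣⇒∣ᵤ 3∣) (from-no (3 ℕ.∣? 1))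
unit-unique-mod-3 (inj₂ (inj₁ refl)) (inj₁ refl) _ = refl
unit-unique-mod-3 (inj₂ (inj₁ refl)) (inj₂ refl) 3∣ = contradiction (ℤ.∣⇒∣ᵤ 3∣) (from-no (3 ℕ.∣? 2))
unit-unique-mod-3 (inj₂ (inj₂ refl)) (inj₁ refl) 3∣ = contradiction (ℤ.∣⇒∣ᵤ 3∣) (from-no (3 ℕ.∣? 2))
unit-unique-mod-3 (inj₂ (inj₂ refl)) (inj₂ refl) _ = refl

legendre₃-unique : ∀ d {u} → IsUnit u → + 3 ∣ˢ d - u → legendre₃ d ≡ u
legendre₃-unique d {u} unit 3∣d-u = unit-unique-mod-3 (legendre₃-range d) unit
  (subst (+ 3 ∣ˢ_) (difference d (legendre₃ d) u) (ℤ.∣m∣n⇒∣m-n 3∣d-u (legendre₃-cong d)))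
  where
  difference : ∀ d L u → (d - u) - (d - L) ≡ L - u
  difference = solve-∀

gcd≡1⇒legendre₃-unit : ∀ {d} → gcd d (+ 3) ≡ 1ℤ → IsUnit (legendre₃ d)
gcd≡1⇒legendre₃-unit {d} gcd≡1 = [ (λ L≡0 → contradiction (3∣1 L≡0) (from-no (3 ℕ.∣? 1))) , id ]′ (legendre₃-range d)
  where
  3∣1 : legendre₃ d ≡ 0ℤ → 3 ℕ.∣ 1
  3∣1 L≡0 = subst (3 ℕ.∣_) (ℤ.+-injective gcd≡1) (ℕ.gcd-greatest {∣ d ∣} {3} (ℤ.∣⇒∣ᵤ 3∣d) ℕ.∣-refl)
    where
    3∣d : + 3 ∣ˢ d
    3∣d = subst (+ 3 ∣ˢ_) (trans (cong (λ L → d - L) L≡0) (ℤ.+-identityʳ d)) (legendre₃-cong d)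

legendre₃-unit⇒gcd≡1 : ∀ {d} → IsUnit (legendre₃ d) → gcd d (+ 3) ≡ 1ℤ
legendre₃-unit⇒gcd≡1 {d} unit = cong +_ (coprime⇒gcd≡1 λ (g∣d , g∣3) → ℕ.∣1⇒≡1 (g∣1 g∣d g∣3))
  where
  g∣1 : ∀ {g} → g ℕ.∣ ∣ d ∣ → g ℕ.∣ 3 → g ℕ.∣ 1
  g∣1 {g} g∣d g∣3 = subst (g ℕ.∣_) (trans (cong ∣_∣ (sym (ℤ.*-identityʳ (legendre₃ d)))) (∣unit*n∣ 1 unit))
    (ℤ.∣⇒∣ᵤ (subst (+ g ∣ˢ_) (back d (legendre₃ d))
      (ℤ.∣m∣n⇒∣m-n (ℤ.∣ᵤ⇒∣ {+ g} {d} g∣d) (ℤ.∣-trans (ℤ.∣ᵤ⇒∣ {+ g} {+ 3} g∣3) (legendre₃-cong d)))))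
    where
    back : ∀ d L → d - (d - L) ≡ L
    back = solve-∀

-- From solutions to pairs (d, z)

-- The radicand (4 |k - z³| - d³) / (3 d) is the square of a natural number
-- t, and x and y are the halves of sgn (k - z³) (d ± t).
HasHalves : (k z d x y : ℤ) → Set
HasHalves k z d x y = ∃[ t ]
    + 4 * + ∣ k - z ^ 3 ∣ - d ^ 3 ≡ + t * + t * (+ 3 * d)
  × sgn (k - z ^ 3) * (d + + t) ≡ + 2 * x
  × sgn (k - z ^ 3) * (d - + t) ≡ + 2 * y

-- The integral content of the passage from a solution (x, y, z) to a pair
-- (d, z).  The inequality d / α < |z| appears with denominators and radicals
-- cleared: as α = 2^(1/3) - 1, it says d + |z| < 2^(1/3) |z|.
record Reduction (k ε x y z d : ℤ) : Set where
  field
    d>0       : 0ℤ < d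
    ∣z∣>0     : 0ℤ < + ∣ z ∣
    cubes     : (d + + ∣ z ∣) ^ 3 < + 2 * (+ ∣ z ∣) ^ 3
    coprime   : gcd d (+ 3) ≡ 1ℤ
    sgn-z     : sgn z ≡ ε * legendre₃ d
    z³≋k      : z ^ 3 ≋ k [mod d ]
    square    : IsSquare (+ 3 * d * (+ 4 * ε * legendre₃ d * (z ^ 3 - k) - d ^ 3))
    hasHalves : HasHalves k z d x y

0<i*j : ∀ {i j} → 0ℤ < i → 0ℤ < j → 0ℤ < i * j
0<i*j {+[1+ _ ]} {+[1+ _ ]} _ _ = +<+ ℕ.z<s
0<i*j {+[1+ _ ]} {+ 0} _ (+<+ ())
0<i*j {+ 0} (+<+ ())

-- A solution (s (Y + e), - s Y, z), for which x + y = s e.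
module OppositeSigns {k ε s : ℤ} (z : ℤ) (Y e : ℕ) (unit-s : IsUnit s) (unit-ε : IsUnit ε)
  (sum≡k : (s * + (Y ℕ.+ e)) ^ 3 + (s * - + Y) ^ 3 + z ^ 3 ≡ k) (e>0 : 0 ℕ.< e) where

  open ℤ.+-*-Solver using (solve; _:=_; _:+_; _:-_; _:*_; _:^_; :-_; con)
  open ≡-Reasoning

  private
    b d q : ℤ
    b = + Y
    d = + e
    q = + 3 * (b * b) + + 3 * (b * d) + d * d

    d>0 : 0ℤ < d
    d>0 = +<+ e>0

    q>0 : 0ℤ < q
    q>0 = ℤ.+-mono-≤-< (ℤ.+-mono-≤ (0≤3ij Y Y) (0≤3ij Y e)) (0<i*j d>0 d>0)
      where
      0≤3ij : ∀ m n → 0ℤ ≤ + 3 * (+ m * + n)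
      0≤3ij m n = subst (0ℤ ≤_) (trans (ℤ.pos-* 3 (m ℕ.* n)) (cong (+ 3 *_) (ℤ.pos-* m n))) (+≤+ ℕ.z≤n)

    k-z³≡sdq : k - z ^ 3 ≡ s * (d * q)
    k-z³≡sdq = begin
      k - z ^ 3                                                       ≡⟨ cong (_- z ^ 3) sum≡k ⟨
      (s * (b + d)) ^ 3 + (s * - b) ^ 3 + z ^ 3 - z ^ 3               ≡⟨ factor s b d z ⟩
      (s * s) * (s * (d * q))                                         ≡⟨ unit²*i≡i _ unit-s ⟩
      s * (d * q)                                                     ∎
      where
      factor : ∀ s b d z → (s * (b + d)) ^ 3 + (s * - b) ^ 3 + z ^ 3 - z ^ 3
        ≡ (s * s) * (s * (d * (+ 3 * (b * b) + + 3 * (b * d) + d * d)))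
      factor = solve 4 (λ s b d z → (s :* (b :+ d)) :^ 3 :+ (s :* :- b) :^ 3 :+ z :^ 3 :- z :^ 3
        := (s :* s) :* (s :* (d :* (con (+ 3) :* (b :* b) :+ con (+ 3) :* (b :* d) :+ d :* d)))) refl

    sgn≡s : sgn (k - z ^ 3) ≡ s
    sgn≡s = trans (cong sgn k-z³≡sdq) (sgn-unit*pos unit-s (0<i*j d>0 q>0))

    t : ℕ
    t = Y ℕ.+ (Y ℕ.+ e)

    -- d times the identity 4 q - d² = 3 (2 b + d)², where q = 3 b² + 3 b d + d².
    complete-square : ∀ b d → + 4 * (d * (+ 3 * (b * b) + + 3 * (b * d) + d * d)) - d ^ 3
      ≡ (b + (b + d)) * (b + (b + d)) * (+ 3 * d)
    complete-square = solve 2 (λ b d →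
      con (+ 4) :* (d :* (con (+ 3) :* (b :* b) :+ con (+ 3) :* (b :* d) :+ d :* d)) :- d :^ 3
        := (b :+ (b :+ d)) :* (b :+ (b :+ d)) :* (con (+ 3) :* d)) refl

  hasHalves : HasHalves k z d (s * + (Y ℕ.+ e)) (s * - + Y)
  hasHalves = t
    , trans (cong (λ i → + 4 * i - d ^ 3) (trans (cong (+_ ∘ ∣_∣) k-z³≡sdq) (∣unit*pos∣ unit-s (0<i*j d>0 q>0))))
            (complete-square b d)
    , trans (cong (_* (d + + t)) sgn≡s) (sum s b d)
    , trans (cong (_* (d - + t)) sgn≡s) (difference s b d)
    where
    sum : ∀ s b d → s * (d + (b + (b + d))) ≡ + 2 * (s * (b + d))
    sum = solve-∀
    difference : ∀ s b d → s * (d - (b + (b + d))) ≡ + 2 * (s * - b)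
    difference = solve-∀

  d∣z³-k : z ^ 3 ≋ k [mod d ]
  d∣z³-k = ℤ.∣⇒∣ᵤ (divides (- (s * q)) (begin
    z ^ 3 - k           ≡⟨ swap (z ^ 3) k ⟩
    - (k - z ^ 3)       ≡⟨ cong -_ k-z³≡sdq ⟩
    - (s * (d * q))     ≡⟨ rearrange s d q ⟩
    - (s * q) * d       ∎))
    where
    swap : ∀ i j → i - j ≡ - (j - i)
    swap = solve-∀
    rearrange : ∀ s d q → - (s * (d * q)) ≡ - (s * q) * d
    rearrange = solve-∀

  isSquare : ∀ {L} → L ≡ - (s * ε) → IsSquare (+ 3 * d * (+ 4 * ε * L * (z ^ 3 - k) - d ^ 3))
  isSquare refl = + 3 * d * + t , (begin
    + 3 * d * (+ 4 * ε * - (s * ε) * (z ^ 3 - k) - d ^ 3)           ≡⟨ collect d ε s (z ^ 3) k (d ^ 3) ⟩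
    + 3 * d * (+ 4 * ((ε * ε) * (s * (k - z ^ 3))) - d ^ 3)         ≡⟨ cong (λ i → + 3 * d * (+ 4 * i - d ^ 3)) (begin
        (ε * ε) * (s * (k - z ^ 3))    ≡⟨ unit²*i≡i _ unit-ε ⟩
        s * (k - z ^ 3)                ≡⟨ cong (s *_) k-z³≡sdq ⟩
        s * (s * (d * q))              ≡⟨ ℤ.*-assoc s s (d * q) ⟨
        s * s * (d * q)                ≡⟨ unit²*i≡i _ unit-s ⟩
        d * q                          ∎) ⟩
    + 3 * d * (+ 4 * (d * q) - d ^ 3)                               ≡⟨ cong (+ 3 * d *_) (complete-square b d) ⟩
    + 3 * d * (+ t * + t * (+ 3 * d))                               ≡⟨ finish d (+ t) ⟩
    (+ 3 * d * + t) * (+ 3 * d * + t)                               ∎)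
    where
    collect : ∀ d ε s c k d³ → + 3 * d * (+ 4 * ε * - (s * ε) * (c - k) - d³)
      ≡ + 3 * d * (+ 4 * ((ε * ε) * (s * (k - c))) - d³)
    collect = solve-∀
    finish : ∀ d t → + 3 * d * (t * t * (+ 3 * d)) ≡ (+ 3 * d * t) * (+ 3 * d * t)
    finish = solve-∀

reduction : ∀ {k ε s z} (Y e Z : ℕ) → IsUnit s → IsUnit ε → z ≡ s * - + Z →
  (s * + (Y ℕ.+ e)) ^ 3 + (s * - + Y) ^ 3 + z ^ 3 ≡ + k → + k ≋ + 3 * ε [mod + 9 ] →
  0 ℕ.< e → Z ℕ.< Y → k ℕ.< Z ℕ.* Z →
  Reduction (+ k) ε (s * + (Y ℕ.+ e)) (s * - + Y) z (+ e)
reduction {k} {ε} {s} {z} Y e Z unit-s unit-ε z≡ sum≡k k≋3ε e>0 Z<Y k<Z² = record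
  { d>0       = +<+ e>0
  ; ∣z∣>0     = subst (λ n → 0ℤ < + n) (sym ∣z∣≡Z) (+<+ Z>0)
  ; cubes     = subst (λ n → (+ e + + n) ^ 3 < + 2 * (+ n) ^ 3) (sym ∣z∣≡Z)
      (≡.subst₂ _<_ (sym (pos-cube (e ℕ.+ Z))) (trans (ℤ.pos-* 2 (Z ℕ.^ 3)) (cong (+ 2 *_) (sym (pos-cube Z))))
        (+<+ (cube-bound Z<Y k<Z² (proj₁ (cube-inequalities {s} {Y ℕ.+ e} {Y} {Z} unit-s sum≡k′)))))
  ; coprime   = legendre₃-unit⇒gcd≡1 {+ e} (subst IsUnit (sym L≡) (unit-neg (unit-* unit-s unit-ε)))
  ; sgn-z     = begin
      sgn z                      ≡⟨ cong sgn z≡-sZ ⟩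
      sgn (- s * + Z)            ≡⟨ sgn-unit*pos (unit-neg unit-s) (+<+ Z>0) ⟩
      - s                        ≡⟨ unit²*i≡i (- s) unit-ε ⟨
      ε * ε * - s                ≡⟨ regroup s ε ⟩
      ε * - (s * ε)              ≡⟨ cong (ε *_) L≡ ⟨
      ε * legendre₃ (+ e)        ∎
  ; z³≋k      = d∣z³-k
  ; square    = isSquare L≡
  ; hasHalves = hasHalves
  }
  where
  open ≡-Reasoning
  open OppositeSigns z Y e unit-s unit-ε sum≡k e>0

  Z>0 : 0 ℕ.< Z
  Z>0 = ℕ.n≢0⇒n>0 λ { refl → ℕ.n≮0 k<Z² }

  sum≡k′ : (s * + (Y ℕ.+ e)) ^ 3 + (s * - + Y) ^ 3 + (s * - + Z) ^ 3 ≡ + k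
  sum≡k′ = subst (λ i → (s * + (Y ℕ.+ e)) ^ 3 + (s * - + Y) ^ 3 + i ^ 3 ≡ + k) z≡ sum≡k

  z≡-sZ : z ≡ - s * + Z
  z≡-sZ = trans z≡ (trans (sym (ℤ.neg-distribʳ-* s (+ Z))) (ℤ.neg-distribˡ-* s (+ Z)))

  ∣z∣≡Z : ∣ z ∣ ≡ Z
  ∣z∣≡Z = trans (cong ∣_∣ z≡-sZ) (∣unit*n∣ Z (unit-neg unit-s))

  regroup : ∀ s ε → ε * ε * - s ≡ ε * - (s * ε)
  regroup = solve-∀

  -- d = s (x + y), and x + y ≡ - ε modulo 3.
  L≡ : legendre₃ (+ e) ≡ - (s * ε)
  L≡ = legendre₃-unique (+ e) (unit-neg (unit-* unit-s unit-ε)) (subst (+ 3 ∣ˢ_) (begin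
    s * (s * + (Y ℕ.+ e) + s * - + Y + ε)   ≡⟨ distribute s (+ Y) (+ e) ε ⟩
    (s * s) * + e - - (s * ε)               ≡⟨ cong (_- - (s * ε)) (unit²*i≡i (+ e) unit-s) ⟩
    + e - - (s * ε)                         ∎)
    (ℤ.∣n⇒∣m*n s (sum-mod-3 (s * + (Y ℕ.+ e)) (s * - + Y) z unit-ε sum≡k k≋3ε)))
    where
    distribute : ∀ s b d ε → s * (s * (b + d) + s * - b + ε) ≡ (s * s) * d - - (s * ε)
    distribute = solve-∀

solution⇒reduction : ∀ {k ε} x y z → IsUnit ε → x ^ 3 + y ^ 3 + z ^ 3 ≡ + k → + k ≋ + 3 * ε [mod + 9 ] →
  ∣ y ∣ ℕ.≤ ∣ x ∣ → ∣ z ∣ ℕ.≤ ∣ y ∣ → y ≢ z → k ℕ.< ∣ z ∣ ℕ.* ∣ z ∣ →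
  Reduction (+ k) ε x y z (+ ∣ x + y ∣)
solution⇒reduction {k} {ε} x y z unit-ε sum≡k k≋3ε y≤x z≤y y≢z k<z²
  with s , unit-s , x≡ , y≡ , z≡ ← sign-pattern x y z y≤x z≤y sum≡k k<z² =
  transport x≡′ y≡ ∣x+y∣≡e (reduction (∣ y ∣) e (∣ z ∣) unit-s unit-ε z≡
    (trans (cong₂ (λ u v → u ^ 3 + v ^ 3 + z ^ 3) (sym x≡′) (sym y≡)) sum≡k)
    k≋3ε (ℕ.m<n⇒0<n∸m y<x) z<y k<z²)
  where
  sum′ : (s * + ∣ x ∣) ^ 3 + (s * - + ∣ y ∣) ^ 3 + (s * - + ∣ z ∣) ^ 3 ≡ + k
  sum′ = trans (sym (cong₂ _+_ (cong₂ _+_ (cong (_^ 3) x≡) (cong (_^ 3) y≡)) (cong (_^ 3) z≡))) sum≡k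

  y<x : ∣ y ∣ ℕ.< ∣ x ∣
  y<x = y<x-of-cubes {k} {∣ x ∣} {∣ y ∣} {∣ z ∣}
    (proj₂ (cube-inequalities {s} {∣ x ∣} {∣ y ∣} {∣ z ∣} unit-s sum′)) k<z²

  z<y : ∣ z ∣ ℕ.< ∣ y ∣
  z<y = ℕ.≤∧≢⇒< z≤y λ ∣z∣≡∣y∣ → y≢z
    (trans y≡ (trans (cong (λ n → s * - + n) (sym ∣z∣≡∣y∣)) (sym z≡)))

  e : ℕ
  e = ∣ x ∣ ℕ.∸ ∣ y ∣

  x≡′ : x ≡ s * + (∣ y ∣ ℕ.+ e)
  x≡′ = trans x≡ (cong (λ n → s * + n) (sym (ℕ.m+[n∸m]≡n y≤x)))

  ∣x+y∣≡e : ∣ x + y ∣ ≡ e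
  ∣x+y∣≡e = trans (cong ∣_∣ (trans (cong₂ _+_ x≡′ y≡) (cancel s (+ ∣ y ∣) (+ e)))) (∣unit*n∣ e unit-s)
    where
    cancel : ∀ s b d → s * (b + d) + s * - b ≡ s * d
    cancel = solve-∀

  transport : ∀ {x x′ y y′ m n} → x ≡ x′ → y ≡ y′ → m ≡ n →
    Reduction (+ k) ε x′ y′ z (+ n) → Reduction (+ k) ε x y z (+ m)
  transport refl refl refl f = f

-- From pairs (d, z) to solutions

-- Put σ = ε (d/3) and m = σ (z³ - k) / d, so that the square is
-- 3 d² (4 m - d²).  Then 3 d divides its root, whence 4 m = 3 t² + d² for
-- some t.  This makes m positive and t ≡ d modulo 2, and with s = - σ the
-- numbers s (d ± t) / 2 solve the equation.
square⇒solution : ∀ {k ε d z} → 0ℤ < d → IsUnit ε → gcd d (+ 3) ≡ 1ℤ → z ^ 3 ≋ k [mod d ] →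
  IsSquare (+ 3 * d * (+ 4 * ε * legendre₃ d * (z ^ 3 - k) - d ^ 3)) →
  ∃[ x ] ∃[ y ] HasHalves k z d x y × x ^ 3 + y ^ 3 + z ^ 3 ≡ k
square⇒solution {k} {ε} {d@(+[1+ _ ])} {z} d>0 unit-ε gcd≡1 z³≋k (n , n-square)
  with divides h z³-k≡hd ← ℤ.∣ᵤ⇒∣ {d} {z ^ 3 - k} z³≋k =
  s * a , s * b , halves , sum≡k
  where
  open ≡-Reasoning
  σ m : ℤ
  σ = ε * legendre₃ d
  m = σ * h

  unit-σ : IsUnit σ
  unit-σ = unit-* unit-ε (gcd≡1⇒legendre₃-unit {d} gcd≡1)

  n²≡ : n * n ≡ + 3 * (+ 4 * m - d * d) * (d * d)
  n²≡ = begin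
    n * n                                                              ≡⟨ n-square ⟨
    + 3 * d * (+ 4 * ε * legendre₃ d * (z ^ 3 - k) - d ^ 3)            ≡⟨ cong (λ i → + 3 * d * (+ 4 * ε * legendre₃ d * i - d ^ 3)) z³-k≡hd ⟩
    + 3 * d * (+ 4 * ε * legendre₃ d * (h * d) - d * (d * (d * 1ℤ)))   ≡⟨ factor ε (legendre₃ d) d h ⟩
    + 3 * (+ 4 * m - d * d) * (d * d)                                  ∎
    where
    factor : ∀ ε L d h → + 3 * d * (+ 4 * ε * L * (h * d) - d * (d * (d * 1ℤ)))
      ≡ + 3 * (+ 4 * (ε * L * h) - d * d) * (d * d)
    factor = solve-∀

  d∣n : d ∣ˢ n
  d∣n = ℤ.∣ᵤ⇒∣ (a²∣b²⇒a∣b ∣ d ∣ ∣ n ∣ (≡.subst₂ ℕ._∣_ (ℤ.abs-* d d) (ℤ.abs-* n n)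
    (ℤ.∣⇒∣ᵤ {d * d} {n * n} (divides (+ 3 * (+ 4 * m - d * d)) n²≡))))

  p : ℤ
  p = _∣ˢ_.quotient d∣n

  p²≡ : p * p ≡ + 3 * (+ 4 * m - d * d)
  p²≡ = ℤ.*-cancelʳ-≡ (p * p) (+ 3 * (+ 4 * m - d * d)) (d * d) (begin
    p * p * (d * d)                      ≡⟨ swap p d ⟩
    (p * d) * (p * d)                    ≡⟨ cong₂ _*_ (_∣ˢ_.equality d∣n) (_∣ˢ_.equality d∣n) ⟨
    n * n                                ≡⟨ n²≡ ⟩
    + 3 * (+ 4 * m - d * d) * (d * d)    ∎)
    where
    swap : ∀ p d → p * p * (d * d) ≡ (p * d) * (p * d)
    swap = solve-∀

  3∣p : + 3 ∣ˢ p
  3∣p = prime∣i²⇒prime∣i p (from-yes (prime? 3)) (divides (+ 4 * m - d * d) (trans p²≡ (ℤ.*-comm (+ 3) _)))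

  r : ℤ
  r = _∣ˢ_.quotient 3∣p

  t : ℕ
  t = ∣ r ∣

  3t²+d²≡4m : + 3 * (+ t * + t) + d * d ≡ + 4 * m
  3t²+d²≡4m = begin
    + 3 * (+ t * + t) + d * d              ≡⟨ cong (λ i → + 3 * i + d * d) (i²≡∣i∣² r) ⟨
    + 3 * (r * r) + d * d                  ≡⟨ cong (_+ d * d) (ℤ.*-cancelʳ-≡ (+ 3 * (r * r)) (+ 4 * m - d * d) (+ 3) (begin
      + 3 * (r * r) * + 3                  ≡⟨ swap r ⟩
      (r * + 3) * (r * + 3)                ≡⟨ cong₂ _*_ (_∣ˢ_.equality 3∣p) (_∣ˢ_.equality 3∣p) ⟨
      p * p                                ≡⟨ p²≡ ⟩
      + 3 * (+ 4 * m - d * d)              ≡⟨ ℤ.*-comm (+ 3) _ ⟩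
      (+ 4 * m - d * d) * + 3              ∎)) ⟩
    + 4 * m - d * d + d * d                ≡⟨ cancel (+ 4 * m) (d * d) ⟩
    + 4 * m                                ∎
    where
    swap : ∀ r → + 3 * (r * r) * + 3 ≡ (r * + 3) * (r * + 3)
    swap = solve-∀
    cancel : ∀ i j → i - j + j ≡ i
    cancel = solve-∀

  m>0 : 0ℤ < m
  m>0 = ℤ.*-cancelˡ-<-nonNeg (+ 4) (subst (0ℤ <_) 3t²+d²≡4m (ℤ.+-mono-≤-< 0≤3t² (0<i*j d>0 d>0)))
    where
    0≤3t² : 0ℤ ≤ + 3 * (+ t * + t)
    0≤3t² = subst (0ℤ ≤_) (trans (ℤ.pos-* 3 (t ℕ.* t)) (cong (+ 3 *_) (ℤ.pos-* t t))) (+≤+ ℕ.z≤n)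

  -- (d + t)² ≡ d² + 3 t² ≡ 4 m modulo 2
  2∣d+t : + 2 ∣ˢ d + + t
  2∣d+t = prime∣i²⇒prime∣i (d + + t) (from-yes (prime? 2)) (divides (+ 2 * m - + t * + t + d * + t) (begin
    (d + + t) * (d + + t)                                           ≡⟨ square d (+ t) ⟩
    (+ 3 * (+ t * + t) + d * d) + + 2 * (d * + t - + t * + t)       ≡⟨ cong (_+ + 2 * (d * + t - + t * + t)) 3t²+d²≡4m ⟩
    + 4 * m + + 2 * (d * + t - + t * + t)                           ≡⟨ halve m d (+ t) ⟩
    (+ 2 * m - + t * + t + d * + t) * + 2                           ∎))
    where
    square : ∀ d t → (d + t) * (d + t) ≡ (+ 3 * (t * t) + d * d) + + 2 * (d * t - t * t)
    square = solve-∀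
    halve : ∀ m d t → + 4 * m + + 2 * (d * t - t * t) ≡ (+ 2 * m - t * t + d * t) * + 2
    halve = solve-∀

  a b : ℤ
  a = _∣ˢ_.quotient 2∣d+t
  b = a - + t

  d+t≡a*2 : d + + t ≡ a * + 2
  d+t≡a*2 = _∣ˢ_.equality 2∣d+t

  d≡a+b : d ≡ a + b
  d≡a+b = begin
    d                  ≡⟨ add d (+ t) ⟩
    d + + t - + t      ≡⟨ cong (_- + t) d+t≡a*2 ⟩
    a * + 2 - + t      ≡⟨ split a (+ t) ⟩
    a + b              ∎
    where
    add : ∀ d t → d ≡ d + t - t
    add = solve-∀
    split : ∀ a t → a * + 2 - t ≡ a + (a - t)
    split = solve-∀

  s : ℤ
  s = - σ

  unit-s : IsUnit s
  unit-s = unit-neg unit-σ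

  k-z³≡sdm : k - z ^ 3 ≡ s * (d * m)
  k-z³≡sdm = begin
    k - z ^ 3                       ≡⟨ swap k (z ^ 3) ⟩
    - (z ^ 3 - k)                   ≡⟨ cong -_ z³-k≡hd ⟩
    - (h * d)                       ≡⟨ unit²*i≡i _ unit-σ ⟨
    σ * σ * - (h * d)               ≡⟨ regroup σ h d ⟩
    - σ * (d * (σ * h))             ∎
    where
    swap : ∀ i j → i - j ≡ - (j - i)
    swap = solve-∀
    regroup : ∀ σ h d → σ * σ * - (h * d) ≡ - σ * (d * (σ * h))
    regroup = solve-∀

  sgn≡s : sgn (k - z ^ 3) ≡ s
  sgn≡s = trans (cong sgn k-z³≡sdm) (sgn-unit*pos unit-s (0<i*j d>0 m>0))

  halves : HasHalves k z d (s * a) (s * b)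
  halves = t
    , (begin
        + 4 * + ∣ k - z ^ 3 ∣ - d ^ 3                    ≡⟨ cong (λ i → + 4 * + ∣ i ∣ - d ^ 3) k-z³≡sdm ⟩
        + 4 * + ∣ s * (d * m) ∣ - d ^ 3                  ≡⟨ cong (λ i → + 4 * i - d ^ 3) (∣unit*pos∣ unit-s (0<i*j d>0 m>0)) ⟩
        + 4 * (d * m) - d * (d * (d * 1ℤ))               ≡⟨ factor d m ⟩
        d * (+ 4 * m - d * d)                            ≡⟨ cong (λ i → d * (i - d * d)) 3t²+d²≡4m ⟨
        d * (+ 3 * (+ t * + t) + d * d - d * d)          ≡⟨ finish d (+ t) ⟩
        + t * + t * (+ 3 * d)                            ∎)
    , trans (cong₂ _*_ sgn≡s d+t≡a*2) (double s a)
    , trans (cong₂ (λ u v → u * (v - + t)) sgn≡s d≡a+b) (double′ s a (+ t))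
    where
    factor : ∀ d m → + 4 * (d * m) - d * (d * (d * 1ℤ)) ≡ d * (+ 4 * m - d * d)
    factor = solve-∀
    finish : ∀ d t → d * (+ 3 * (t * t) + d * d - d * d) ≡ t * t * (+ 3 * d)
    finish = solve-∀
    double : ∀ s a → s * (a * + 2) ≡ + 2 * (s * a)
    double = solve-∀
    double′ : ∀ s a t → s * (a + (a - t) - t) ≡ + 2 * (s * (a - t))
    double′ = solve-∀

  -- 4 (a² - a b + b²) = d² + 3 t²
  m≡a²-ab+b² : m ≡ a * a - a * b + b * b
  m≡a²-ab+b² = ℤ.*-cancelˡ-≡ (+ 4) _ _ (begin
    + 4 * m                                              ≡⟨ 3t²+d²≡4m ⟨
    + 3 * (+ t * + t) + d * d                            ≡⟨ cong (λ i → + 3 * (+ t * + t) + i * i) d≡a+b ⟩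
    + 3 * (+ t * + t) + (a + b) * (a + b)                ≡⟨ quadratic a (+ t) ⟩
    + 4 * (a * a - a * b + b * b)                        ∎)
    where
    quadratic : ∀ a t → let b = a - t in
      + 3 * (t * t) + (a + b) * (a + b) ≡ + 4 * (a * a - a * b + b * b)
    quadratic = solve-∀

  sum≡k : (s * a) ^ 3 + (s * b) ^ 3 + z ^ 3 ≡ k
  sum≡k = begin
    (s * a) ^ 3 + (s * b) ^ 3 + z ^ 3                                       ≡⟨ factor s a b (z ^ 3) ⟩
    (s * s) * (s * ((a + b) * (a * a - a * b + b * b))) + z ^ 3             ≡⟨ cong (_+ z ^ 3) (unit²*i≡i _ unit-s) ⟩
    s * ((a + b) * (a * a - a * b + b * b)) + z ^ 3                         ≡⟨ cong₂ (λ u v → s * (u * v) + z ^ 3) d≡a+b m≡a²-ab+b² ⟨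
    s * (d * m) + z ^ 3                                                     ≡⟨ cong (_+ z ^ 3) k-z³≡sdm ⟨
    k - z ^ 3 + z ^ 3                                                       ≡⟨ cancel k (z ^ 3) ⟩
    k                                                                       ∎
    where
    cancel : ∀ i j → i - j + j ≡ i
    cancel = solve-∀
    factor : ∀ s a b c → (s * a) ^ 3 + (s * b) ^ 3 + c
      ≡ (s * s) * (s * ((a + b) * (a * a - a * b + b * b))) + c
    factor = solve 4 (λ s a b c → (s :* a) :^ 3 :+ (s :* b) :^ 3 :+ c
      := (s :* s) :* (s :* ((a :+ b) :* (a :* a :- a :* b :+ b :* b))) :+ c) refl
      where open ℤ.+-*-Solver
square⇒solution {d = + 0} (+<+ ())

-- Real numbers

-- Consequences of the axioms for the real numbers.
module RealLemmas {c ℓ₁ ℓ₂} (R : Reals c ℓ₁ ℓ₂) where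

  open RealNotions R
  open Reals R
    using (commutativeRing; heytingCommutativeRing; #⇒invertible; <⇒#; #⇒<⊎>; #-cotrans; tight;
           isStrictPartialOrder; +-monoˡ-<; *-pos; root-nonNeg; root-^)
  private
    module CR = CommutativeRing commutativeRing
    module < = IsStrictPartialOrder isStrictPartialOrder
  open SemiringMult CR.semiring using (×-homo-+; ×1-homo-*)
  open RingProperties CR.ring
    using (-0#≈0#; -‿distribˡ-*; -‿distribʳ-*; -‿involutive; -‿+-comm)
  open HeytingProperties heytingCommutativeRing using (x-0≈x; invertibleʳ⇒#)

  ι-neg : ∀ i → ι (- i) ≈ -ᴿ ι i
  ι-neg (+ zero)    = CR.sym -0#≈0#
  ι-neg (+ (suc n)) = CR.refl
  ι-neg -[1+ n ]    = CR.sym (-‿involutive _)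

  ι-⊖ : ∀ m n → ι (m ⊖ n) ≈ ι (+ m) -ᴿ ι (+ n)
  ι-⊖ m zero = CR.sym (x-0≈x _)
  ι-⊖ zero (suc n) = CR.sym (CR.+-identityˡ _)
  ι-⊖ (suc m) (suc n) = begin
    ι (suc m ⊖ suc n)                         ≡⟨ cong ι (ℤ.[1+m]⊖[1+n]≡m⊖n m n) ⟩
    ι (m ⊖ n)                                 ≈⟨ ι-⊖ m n ⟩
    u -ᴿ v                                    ≈⟨ CR.+-congʳ (CR.+-identityˡ u) ⟨
    0# +ᴿ u -ᴿ v                              ≈⟨ CR.+-congʳ (CR.+-congʳ (CR.-‿inverseʳ 1#)) ⟨
    1# -ᴿ 1# +ᴿ u -ᴿ v                        ≈⟨ CR.+-congʳ (CR.+-assoc _ _ _) ⟩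
    1# +ᴿ (-ᴿ 1# +ᴿ u) -ᴿ v                   ≈⟨ CR.+-congʳ (CR.+-congˡ (CR.+-comm _ _)) ⟩
    1# +ᴿ (u -ᴿ 1#) -ᴿ v                      ≈⟨ CR.+-congʳ (CR.+-assoc _ _ _) ⟨
    1# +ᴿ u -ᴿ 1# -ᴿ v                        ≈⟨ CR.+-assoc _ _ _ ⟩
    1# +ᴿ u +ᴿ (-ᴿ 1# -ᴿ v)                   ≈⟨ CR.+-congˡ (-‿+-comm _ _) ⟩
    1# +ᴿ u -ᴿ (1# +ᴿ v)                      ∎
    where
    open ≈-Reasoning CR.setoid
    u = ι (+ m)
    v = ι (+ n)

  ι-+ : ∀ i j → ι (i + j) ≈ ι i +ᴿ ι j
  ι-+ (+ m)    (+ n)    = ×-homo-+ 1# m n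
  ι-+ (+ m)    -[1+ n ] = ι-⊖ m (suc n)
  ι-+ -[1+ m ] (+ n)    = CR.trans (ι-⊖ n (suc m)) (CR.+-comm _ _)
  ι-+ -[1+ m ] -[1+ n ] = begin
    ι (-[1+ m ] + -[1+ n ])        ≡⟨ cong ι (ℤ.neg-distrib-+ (+ suc m) (+ suc n)) ⟨
    ι (- (+ suc m + + suc n))      ≈⟨ ι-neg (+ suc m + + suc n) ⟩
    -ᴿ ι (+ (suc m ℕ.+ suc n))     ≈⟨ CR.-‿cong (×-homo-+ 1# (suc m) (suc n)) ⟩
    -ᴿ (ι (+ suc m) +ᴿ ι (+ suc n)) ≈⟨ -‿+-comm _ _ ⟨
    ι -[1+ m ] +ᴿ ι -[1+ n ]       ∎
    where open ≈-Reasoning CR.setoid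

  ι-* : ∀ i j → ι (i * j) ≈ ι i *ᴿ ι j
  ι-* (+ m) j = nonNegˡ j
    where
    open ≈-Reasoning CR.setoid

    nonNegˡ : ∀ j → ι (+ m * j) ≈ ι (+ m) *ᴿ ι j
    nonNegˡ (+ n) = begin
      ι (+ m * + n)               ≡⟨ cong ι (ℤ.pos-* m n) ⟨
      ι (+ (m ℕ.* n))             ≈⟨ ×1-homo-* m n ⟩
      ι (+ m) *ᴿ ι (+ n)          ∎
    nonNegˡ -[1+ n ] = begin
      ι (+ m * - (+ suc n))       ≡⟨ cong ι (ℤ.neg-distribʳ-* (+ m) (+ suc n)) ⟨
      ι (- (+ m * + suc n))       ≈⟨ ι-neg (+ m * + suc n) ⟩
      -ᴿ ι (+ m * + suc n)        ≈⟨ CR.-‿cong (nonNegˡ (+ suc n)) ⟩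
      -ᴿ (ι (+ m) *ᴿ ι (+ suc n)) ≈⟨ -‿distribʳ-* _ _ ⟩
      ι (+ m) *ᴿ ι -[1+ n ]       ∎
  ι-* -[1+ m ] j = begin
    ι (- (+ suc m) * j)           ≡⟨ cong ι (ℤ.neg-distribˡ-* (+ suc m) j) ⟨
    ι (- (+ suc m * j))           ≈⟨ ι-neg (+ suc m * j) ⟩
    -ᴿ ι (+ suc m * j)            ≈⟨ CR.-‿cong (ι-* (+ suc m) j) ⟩
    -ᴿ (ι (+ suc m) *ᴿ ι j)       ≈⟨ -‿distribˡ-* _ _ ⟩
    ι -[1+ m ] *ᴿ ι j             ∎
    where open ≈-Reasoning CR.setoid

  ι-morphism : CommutativeRing.rawRing ℤ.+-*-commutativeRing
                 -Raw-AlmostCommutative⟶ fromCommutativeRing commutativeRing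
  ι-morphism = record
    { ⟦_⟧    = ι
    ; +-homo = ι-+
    ; *-homo = ι-*
    ; -‿homo = ι-neg
    ; 0-homo = CR.refl
    ; 1-homo = CR.+-identityʳ 1#
    }

  -- The ring solver for the reals, with integer coefficients embedded by ι.
  open RingSolver (CommutativeRing.rawRing ℤ.+-*-commutativeRing)
         (fromCommutativeRing commutativeRing) ι-morphism
         (λ i j → Maybe.map (CR.reflexive ∘ cong ι) (dec⇒maybe (i ℤ.≟ j)))

  private
    variable
      u v w : ℝ

  0<v-u⇒u<v : 0# <ᴿ v -ᴿ u → u <ᴿ v
  0<v-u⇒u<v {v} {u} 0<v-u =
    <.<-respˡ-≈ (CR.+-identityˡ u)
      (<.<-respʳ-≈ (solve 2 (λ v u → v :- u :+ u := v) CR.refl v u) (+-monoˡ-< u 0<v-u))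

  u<v⇒0<v-u : u <ᴿ v → 0# <ᴿ v -ᴿ u
  u<v⇒0<v-u {u} u<v = <.<-respˡ-≈ (CR.-‿inverseʳ u) (+-monoˡ-< (-ᴿ u) u<v)

  -- As u ≤ v means that v < u is impossible, transitivity across ≤ needs the
  -- cotransitivity of apartness.
  <-≤-trans : u <ᴿ v → v ≤ᴿ w → u <ᴿ w
  <-≤-trans {w = w} u<v v≤w with #-cotrans (<⇒# u<v) w
  ... | inj₁ u#w with #⇒<⊎> u#w
  ...   | inj₁ u<w = u<w
  ...   | inj₂ w<u = contradiction (<.trans w<u u<v) v≤w
  <-≤-trans {w = w} u<v v≤w | inj₂ w#v with #⇒<⊎> w#v
  ...   | inj₁ w<v = contradiction w<v v≤w
  ...   | inj₂ v<w = <.trans u<v v<w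

  ≤-<-trans : u ≤ᴿ v → v <ᴿ w → u <ᴿ w
  ≤-<-trans {u = u} u≤v v<w with #-cotrans (<⇒# v<w) u
  ... | inj₁ v#u with #⇒<⊎> v#u
  ...   | inj₁ v<u = contradiction v<u u≤v
  ...   | inj₂ u<v = <.trans u<v v<w
  ≤-<-trans {u = u} u≤v v<w | inj₂ u#w with #⇒<⊎> u#w
  ...   | inj₁ u<w = u<w
  ...   | inj₂ w<u = contradiction (<.trans v<w w<u) u≤v

  +-pos : 0# <ᴿ u → 0# <ᴿ v → 0# <ᴿ u +ᴿ v
  +-pos {u} {v} 0<u 0<v = <.trans 0<v (<.<-respˡ-≈ (CR.+-identityˡ v) (+-monoˡ-< v 0<u))

  *-monoˡ-<-pos : 0# <ᴿ w → u <ᴿ v → u *ᴿ w <ᴿ v *ᴿ w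
  *-monoˡ-<-pos {w} {u} {v} 0<w u<v = 0<v-u⇒u<v
    (<.<-respʳ-≈ (solve 3 (λ u v w → (v :- u) :* w := v :* w :- u :* w) CR.refl u v w)
      (*-pos (u<v⇒0<v-u u<v) 0<w))

  -- If i is an inverse of u v, then u i is an inverse of v.
  0<u*v⇒v#0 : 0# <ᴿ u *ᴿ v → v # 0#
  0<u*v⇒v#0 {u} {v} 0<uv with #⇒invertible (<⇒# 0<uv)
  ... | i , _ , [0-uv]i≈1 = invertibleʳ⇒# (-ᴿ u *ᴿ i , (begin
    (v -ᴿ 0#) *ᴿ (-ᴿ u *ᴿ i)    ≈⟨ solve 3 (λ u v i → (v :- con 0ℤ) :* (:- u :* i)
                                      := (con 0ℤ :- u :* v) :* i) CR.refl u v i ⟩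
    (0# -ᴿ u *ᴿ v) *ᴿ i         ≈⟨ [0-uv]i≈1 ⟩
    1#                          ∎))
    where open ≈-Reasoning CR.setoid

  *-cancelˡ-pos : 0# <ᴿ u → 0# <ᴿ u *ᴿ v → 0# <ᴿ v
  *-cancelˡ-pos {u} {v} 0<u 0<uv = [ (λ v<0 → contradiction (uv<0 v<0) (<.asym 0<uv)) , id ]′
    (#⇒<⊎> (0<u*v⇒v#0 0<uv))
    where
    uv<0 : v <ᴿ 0# → u *ᴿ v <ᴿ 0#
    uv<0 v<0 = <.<-respˡ-≈ (CR.*-comm v u) (<.<-respʳ-≈ (CR.zeroˡ u) (*-monoˡ-<-pos 0<u v<0))

  *-cancelʳ-<-pos : 0# <ᴿ w → u *ᴿ w <ᴿ v *ᴿ w → u <ᴿ v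
  *-cancelʳ-<-pos {w} {u} {v} 0<w uw<vw = 0<v-u⇒u<v (*-cancelˡ-pos 0<w
    (<.<-respʳ-≈ (solve 3 (λ u v w → v :* w :- u :* w := w :* (v :- u)) CR.refl u v w)
      (u<v⇒0<v-u uw<vw)))

  cube-cancel-< : 0# <ᴿ u → 0# <ᴿ v → u *ᴿ (u *ᴿ u) <ᴿ v *ᴿ (v *ᴿ v) → u <ᴿ v
  cube-cancel-< {u} {v} 0<u 0<v u³<v³ = 0<v-u⇒u<v
    (*-cancelˡ-pos (+-pos (+-pos (*-pos 0<v 0<v) (*-pos 0<v 0<u)) (*-pos 0<u 0<u))
      (<.<-respʳ-≈ (solve 2 (λ u v → v :* (v :* v) :- u :* (u :* u)
                                  := (v :* v :+ v :* u :+ u :* u) :* (v :- u)) CR.refl u v)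
        (u<v⇒0<v-u u³<v³)))

  square-mono-< : 0# ≤ᴿ u → u <ᴿ v → u *ᴿ u <ᴿ v *ᴿ v
  square-mono-< {u} {v} 0≤u u<v = 0<v-u⇒u<v
    (<.<-respʳ-≈ (solve 2 (λ u v → (v :- u) :* (v :- :- u) := v :* v :- u :* u) CR.refl u v)
      (*-pos (u<v⇒0<v-u u<v) (u<v⇒0<v-u (≤-<-trans -u≤0 (≤-<-trans 0≤u u<v)))))
    where
    -u≤0 : -ᴿ u ≤ᴿ 0#
    -u≤0 0<-u = 0≤u (0<v-u⇒u<v (<.<-respʳ-≈ (CR.sym (CR.+-identityˡ _)) 0<-u))

  square-injective : 0# ≤ᴿ u → 0# ≤ᴿ v → u *ᴿ u ≈ v *ᴿ v → u ≈ v
  square-injective {u} {v} 0≤u 0≤v u²≈v² = proj₁ (tight u v) λ u#v → case (#⇒<⊎> u#v)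
    where
    case : ¬ (u <ᴿ v ⊎ v <ᴿ u)
    case (inj₁ u<v) = <.irrefl u²≈v² (square-mono-< 0≤u u<v)
    case (inj₂ v<u) = <.irrefl (CR.sym u²≈v²) (square-mono-< 0≤v v<u)

  ι-mono-< : ∀ {i j} → i < j → ι i <ᴿ ι j
  ι-mono-< {i} {j} i<j = 0<v-u⇒u<v (<.<-respʳ-≈ (CR.trans (ι-+ j (- i)) (CR.+-congˡ (ι-neg i)))
    (ι-pos (≡.subst (_< j - i) (ℤ.+-inverseʳ i) (ℤ.+-monoˡ-< (- i) i<j))))

  ι-mono-≤ : ∀ {i j} → i ≤ j → ι i ≤ᴿ ι j
  ι-mono-≤ {i} {j} i≤j ιj<ιi with i ℤ.≟ j
  ... | yes refl = <.irrefl CR.refl ιj<ιi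
  ... | no  i≢j  = <.asym ιj<ιi (ι-mono-< (ℤ.≤∧≢⇒< i≤j i≢j))

  ι-cancel-< : ∀ {i j} → ι i <ᴿ ι j → i < j
  ι-cancel-< ιi<ιj = ℤ.≰⇒> λ j≤i → ι-mono-≤ j≤i ιi<ιj

  √-of-square : ∀ {x} (x≥0 : x ≥ᴿ0) → 0# ≤ᴿ u → x ≈ u *ᴿ u → √ x x≥0 ≈ u
  √-of-square {u} {x} x≥0 0≤u x≈u² = square-injective (root-nonNeg 2 x x≥0) 0≤u (begin
    √ x x≥0 *ᴿ √ x x≥0          ≈⟨ CR.*-congˡ (CR.*-identityʳ _) ⟨
    √ x x≥0 *ᴿ (√ x x≥0 *ᴿ 1#)  ≈⟨ root-^ 2 x x≥0 ⟩
    x                           ≈⟨ x≈u² ⟩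
    u *ᴿ u                      ∎)
    where open ≈-Reasoning CR.setoid

  √k<n⇒k<n² : ∀ {k n} (k≥0 : ι k ≥ᴿ0) → √ (ι k) k≥0 <ᴿ ι n → k < n * n
  √k<n⇒k<n² {k} {n} k≥0 √k<n = ι-cancel-<
    (<.<-respˡ-≈ (CR.trans (CR.*-congˡ (CR.sym (CR.*-identityʳ _))) (root-^ 2 (ι k) k≥0))
      (<.<-respʳ-≈ (CR.sym (ι-* n n)) (square-mono-< (root-nonNeg 2 (ι k) k≥0) √k<n)))

  *-inverse : (u#0 : u # 0#) → u *ᴿ proj₁ (#⇒invertible u#0) ≈ 1#
  *-inverse u#0 = CR.trans (CR.*-congʳ (CR.sym (x-0≈x _))) (proj₂ (proj₂ (#⇒invertible u#0)))

  /-* : ∀ {x} (u#0 : u # 0#) → x / u [ u#0 ] *ᴿ u ≈ x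
  /-* {u} {x} u#0 = begin
    x *ᴿ u⁻¹ *ᴿ u    ≈⟨ CR.*-assoc _ _ _ ⟩
    x *ᴿ (u⁻¹ *ᴿ u)  ≈⟨ CR.*-congˡ (CR.*-comm _ _) ⟩
    x *ᴿ (u *ᴿ u⁻¹)  ≈⟨ CR.*-congˡ (*-inverse u#0) ⟩
    x *ᴿ 1#          ≈⟨ CR.*-identityʳ x ⟩
    x                ∎
    where
    open ≈-Reasoning CR.setoid
    u⁻¹ = proj₁ (#⇒invertible u#0)

  *-/ : ∀ {x} (u#0 : u # 0#) → (x *ᴿ u) / u [ u#0 ] ≈ x
  *-/ {u} {x} u#0 = CR.trans (CR.*-assoc _ _ _) (CR.trans (CR.*-congˡ (*-inverse u#0)) (CR.*-identityʳ x))

  ι-cube : ∀ i → ι (i ^ 3) ≈ ι i *ᴿ (ι i *ᴿ ι i)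
  ι-cube i = CR.trans (ι-* i _) (CR.*-congˡ (CR.trans (ι-* i _)
    (CR.*-congˡ (CR.reflexive (cong ι (ℤ.*-identityʳ i))))))

  -- The facts about α = ∛2 - 1 hold for c - 1 whenever c ≥ 0 and c³ ≈ 2;
  -- d < n (c - 1) means d + n < c n, which may be checked on cubes.
  module CubeRootOf2 (c : ℝ) (c≥0 : 0# ≤ᴿ c) (c³≈2 : c *ᴿ (c *ᴿ c) ≈ ι (+ 2)) where

    c²c≈2 : (c *ᴿ c) *ᴿ c ≈ ι (+ 2)
    c²c≈2 = CR.trans (CR.*-assoc c c c) c³≈2

    0<c²c : 0# <ᴿ (c *ᴿ c) *ᴿ c
    0<c²c = <.<-respʳ-≈ (CR.sym c²c≈2) (ι-pos 2>0)

    c>0 : 0# <ᴿ c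
    c>0 = [ (λ c<0 → contradiction c<0 c≥0) , id ]′ (#⇒<⊎> (0<u*v⇒v#0 0<c²c))

    c-1>0 : 0# <ᴿ c -ᴿ ι 1ℤ
    c-1>0 = u<v⇒0<v-u (cube-cancel-< (ι-pos 1>0) c>0
      (<.<-respˡ-≈ (ι-cube 1ℤ) (<.<-respʳ-≈ (CR.sym c³≈2) (ι-mono-< 1<2))))
      where
      1>0 : 0ℤ < 1ℤ
      1>0 = +<+ (ℕ.s≤s ℕ.z≤n)
      1<2 : 1ℤ < + 2
      1<2 = +<+ (ℕ.s≤s (ℕ.s≤s ℕ.z≤n))

    cubes⇒d<n[c-1] : ∀ {d n} → 0ℤ < d → 0ℤ < n → (d + n) ^ 3 < + 2 * n ^ 3 →
      ι d <ᴿ ι n *ᴿ (c -ᴿ ι 1ℤ)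
    cubes⇒d<n[c-1] {d} {n} 0<d 0<n lt =
      0<v-u⇒u<v (<.<-respʳ-≈ shift (u<v⇒0<v-u d+n<cn))
      where
      shift : c *ᴿ ι n -ᴿ (ι d +ᴿ ι n) ≈ ι n *ᴿ (c -ᴿ ι 1ℤ) -ᴿ ι d
      shift = solve 3 (λ c d n → c :* n :- (d :+ n) := n :* (c :- con 1ℤ) :- d) CR.refl c (ι d) (ι n)

      rhs : ι (+ 2 * n ^ 3) ≈ (c *ᴿ ι n) *ᴿ ((c *ᴿ ι n) *ᴿ (c *ᴿ ι n))
      rhs = begin
        ι (+ 2 * n ^ 3)                                 ≈⟨ ι-* (+ 2) (n ^ 3) ⟩
        ι (+ 2) *ᴿ ι (n ^ 3)                            ≈⟨ CR.*-cong c³≈2 (CR.sym (ι-cube n)) ⟨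
        (c *ᴿ (c *ᴿ c)) *ᴿ (ι n *ᴿ (ι n *ᴿ ι n))        ≈⟨ solve 2 (λ c n →
          (c :* (c :* c)) :* (n :* (n :* n)) := (c :* n) :* ((c :* n) :* (c :* n))) CR.refl c (ι n) ⟩
        (c *ᴿ ι n) *ᴿ ((c *ᴿ ι n) *ᴿ (c *ᴿ ι n))        ∎
        where open ≈-Reasoning CR.setoid

      d+n<cn : ι d +ᴿ ι n <ᴿ c *ᴿ ι n
      d+n<cn = <.<-respˡ-≈ (ι-+ d n) (cube-cancel-<
        (ι-pos (ℤ.+-mono-< 0<d 0<n)) (*-pos c>0 (ι-pos 0<n))
        (<.<-respˡ-≈ (ι-cube (d + n)) (<.<-respʳ-≈ rhs (ι-mono-< lt))))

  ∛2 : ℝ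
  ∛2 = ∛ (ι (+ 2)) (ι-nonNeg 2>0)

  ∛2³≈2 : ∛2 *ᴿ (∛2 *ᴿ ∛2) ≈ ι (+ 2)
  ∛2³≈2 = CR.trans (CR.*-congˡ (CR.*-congˡ (CR.sym (CR.*-identityʳ ∛2))))
                   (root-^ 3 (ι (+ 2)) (ι-nonNeg 2>0))

  open CubeRootOf2 ∛2 (root-nonNeg 3 (ι (+ 2)) (ι-nonNeg 2>0)) ∛2³≈2

  α>0 : 0# <ᴿ α
  α>0 = c-1>0

  cubes⇒d/α<n : ∀ {d n} → 0ℤ < d → 0ℤ < n → (d + n) ^ 3 < + 2 * n ^ 3 → ι d / α [ α#0 ] <ᴿ ι n
  cubes⇒d/α<n {d} {n} 0<d 0<n lt = *-cancelʳ-<-pos α>0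
    (<.<-respˡ-≈ (CR.sym (/-* α#0)) (cubes⇒d<n[c-1] 0<d 0<n lt))

  d/α<n≤B⇒d<αB : ∀ {x B} → x / α [ α#0 ] <ᴿ u → u ≤ᴿ B → x <ᴿ α *ᴿ B
  d/α<n≤B⇒d<αB {x = x} {B} x/α<u u≤B = <.<-respˡ-≈ (/-* α#0) (<.<-respʳ-≈ (CR.*-comm B α)
    (*-monoˡ-<-pos α>0 (<-≤-trans x/α<u u≤B)))

  half : ∀ s w {x} → s * w ≡ + 2 * x → u ≈ ι w → ι x ≈ ½ *ᴿ ι s *ᴿ u
  half {u} s w {x} sw≡2x u≈w = begin
    ι x                        ≈⟨ CR.*-identityˡ (ι x) ⟨
    1# *ᴿ ι x                  ≈⟨ CR.*-congʳ (/-* (ι-#0 2>0)) ⟨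
    ½ *ᴿ ι (+ 2) *ᴿ ι x        ≈⟨ CR.*-assoc _ _ _ ⟩
    ½ *ᴿ (ι (+ 2) *ᴿ ι x)      ≈⟨ CR.*-congˡ (ι-* (+ 2) x) ⟨
    ½ *ᴿ ι (+ 2 * x)           ≡⟨ cong (λ i → ½ *ᴿ ι i) sw≡2x ⟨
    ½ *ᴿ ι (s * w)             ≈⟨ CR.*-congˡ (ι-* s w) ⟩
    ½ *ᴿ (ι s *ᴿ ι w)          ≈⟨ CR.*-congˡ (CR.*-congˡ u≈w) ⟨
    ½ *ᴿ (ι s *ᴿ u)            ≈⟨ CR.*-assoc _ _ _ ⟨
    ½ *ᴿ ι s *ᴿ u              ∎
    where open ≈-Reasoning CR.setoid

  halves⇒values : ∀ {k z d x y} (d>0 : 0ℤ < d) → HasHalves k z d x y →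
    Σ[ r≥0 ∈ radicand k z d d>0 ≥ᴿ0 ]
      (ι x ≈ value₊ k z d d>0 r≥0) × (ι y ≈ value₋ k z d d>0 r≥0)
  halves⇒values {k} {z} {d} {x} {y} d>0 (t , radicand-eq , x-half , y-half) =
      radicand≥0
    , half (sgn (k - z ^ 3)) (d + + t) x-half (CR.trans (CR.+-congˡ √≈t) (CR.sym (ι-+ d (+ t))))
    , half (sgn (k - z ^ 3)) (d - + t) y-half (begin
        ι d -ᴿ √ (radicand k z d d>0) radicand≥0  ≈⟨ CR.+-congˡ (CR.-‿cong √≈t) ⟩
        ι d -ᴿ ι (+ t)                            ≈⟨ CR.+-congˡ (ι-neg (+ t)) ⟨
        ι d +ᴿ ι (- (+ t))                        ≈⟨ ι-+ d (- (+ t)) ⟨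
        ι (d - + t)                               ∎)
    where
    open ≈-Reasoning CR.setoid

    radicand≈t² : radicand k z d d>0 ≈ ι (+ t * + t)
    radicand≈t² = begin
      ι (+ 4 * + ∣ k - z ^ 3 ∣ - d ^ 3) / ι (+ 3 * d) [ 3d#0 ]  ≡⟨ cong (λ i → ι i / ι (+ 3 * d) [ 3d#0 ]) radicand-eq ⟩
      ι (+ t * + t * (+ 3 * d)) / ι (+ 3 * d) [ 3d#0 ]          ≈⟨ CR.*-congʳ (ι-* (+ t * + t) (+ 3 * d)) ⟩
      (ι (+ t * + t) *ᴿ ι (+ 3 * d)) / ι (+ 3 * d) [ 3d#0 ]     ≈⟨ *-/ 3d#0 ⟩
      ι (+ t * + t)                                             ∎
      where 3d#0 = ι-#0 (3d>0 d>0)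

    radicand≥0 : radicand k z d d>0 ≥ᴿ0
    radicand≥0 r<0 = ι-mono-≤ {0ℤ} {+ t * + t} (subst (0ℤ ≤_) (ℤ.pos-* t t) (+≤+ ℕ.z≤n))
      (<.<-respˡ-≈ radicand≈t² r<0)

    √≈t : √ (radicand k z d d>0) radicand≥0 ≈ ι (+ t)
    √≈t = √-of-square radicand≥0 (ι-mono-≤ {0ℤ} {+ t} (+≤+ ℕ.z≤n))
      (CR.trans radicand≈t² (ι-* (+ t) (+ t)))

mainTheorem2 : ∀ {c ℓ₁ ℓ₂} (R : Reals c ℓ₁ ℓ₂) → let open RealNotions R in
    ∀ (k : ℤ) (k>0 : 0ℤ < k) →
    (k ≋ + 3 [mod + 9 ]) ⊎ (k ≋ - (+ 3) [mod + 9 ]) →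
    ∀ (ε : ℤ) → (ε ≡ 1ℤ) ⊎ (ε ≡ -1ℤ) → k ≋ + 3 * ε [mod + 9 ] →
    ∀ (B : ℝ) → 0# <ᴿ B →
    (∀ (x y z : ℤ) →
    x ^ 3 + y ^ 3 + z ^ 3 ≡ k →
    ∣ x ∣ ≥ℕ ∣ y ∣ → ∣ y ∣ ≥ℕ ∣ z ∣ → √ (ι k) (ι-nonNeg k>0) <ᴿ ι (+ ∣ z ∣) →
    y ≢ z → ι (+ ∣ z ∣) ≤ᴿ B →
    let d = + ∣ x + y ∣ in
    Σ[ d>0 ∈ 0ℤ < d ]
    (ι d <ᴿ α *ᴿ B)
    × gcd d (+ 3) ≡ 1ℤ
    × S k ε B d z
    × (Σ[ r≥0 ∈ radicand k z d d>0 ≥ᴿ0 ]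
    ⟅ ι x , ι y ⟆ ≐ ⟅ value₊ k z d d>0 r≥0 , value₋ k z d d>0 r≥0 ⟆))
    ×
    (∀ (d : ℤ) (d>0 : 0ℤ < d) → ι d <ᴿ α *ᴿ B → gcd d (+ 3) ≡ 1ℤ →
    ∀ (z : ℤ) → S k ε B d z →
    Σ[ r≥0 ∈ radicand k z d d>0 ≥ᴿ0 ]
    ∃[ x ] ∃[ y ]
    (ι x ≈ value₊ k z d d>0 r≥0)
    × (ι y ≈ value₋ k z d d>0 r≥0)
    × x ^ 3 + y ^ 3 + z ^ 3 ≡ k)
mainTheorem2 R k@(+[1+ _ ]) k>0 _ ε unit-ε k≋3ε B _ =
    (λ x y z sum≡k x≥y y≥z √k<z y≢z z≤B →
      let d = + ∣ x + y ∣
          k<z² = ℤ.drop‿+<+ (subst (k <_) (sym (ℤ.pos-* ∣ z ∣ ∣ z ∣)) (√k<n⇒k<n² {k} {+ ∣ z ∣} (ι-nonNeg k>0) √k<z))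
          open Reduction (solution⇒reduction x y z unit-ε sum≡k k≋3ε x≥y y≥z y≢z k<z²)
          d/α<z = cubes⇒d/α<n d>0 ∣z∣>0 cubes
          r≥0 , x≈ , y≈ = halves⇒values {k} {z} {d} {x} {y} d>0 hasHalves
      in  d>0
        , d/α<n≤B⇒d<αB d/α<z z≤B
        , coprime
        , ((d/α<z , z≤B) , sgn-z , z³≋k , square)
        , r≥0
        , Sum.map (λ t≈x → ≈-trans t≈x x≈) (λ t≈y → ≈-trans t≈y y≈)
        , Sum.map (λ t≈v → ≈-trans t≈v (≈-sym x≈)) (λ t≈v → ≈-trans t≈v (≈-sym y≈)))
  , (λ d d>0 _ gcd≡1 z (_ , _ , z³≋k , square) →
      let x , y , halves , sum≡k = square⇒solution {k} {ε} {d} {z} d>0 unit-ε gcd≡1 z³≋k square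
          r≥0 , x≈ , y≈ = halves⇒values {k} {z} {d} {x} {y} d>0 halves
      in  r≥0 , x , y , x≈ , y≈ , sum≡k)
  where
  open RealNotions R
  open RealLemmas R
  open CommutativeRing (Reals.commutativeRing R) using () renaming (trans to ≈-trans; sym to ≈-sym)
mainTheorem2 R (+ 0) (+<+ ())
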